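{- If $g\in\mathcal{G}$ is $\mathbb{S}$-nearly periodic, then for every $\delta>0$ there exists an $\mathbb{S}$-normal function $h\in\mathcal{G}$ that is not 1-pass tractable and satisfies $\Theta(g,h)\le\delta$.
   Context: Streams: a stream of length $m$ with domain $[n]$ is a list $D=\langle (i_1,\delta_1),\dots,(i_m,\delta_m)\rangle$ with $i_j\in[n]$, $\delta_j\in\mathbb{Z}$; its frequency vector $V(D)=v\in\mathbb{Z}^n$ has $v_i=\sum_{j:i_j=i}\delta_j$. (Turnstile model) there is $M\in\mathbb{N}$ such that the frequency vector of $D$ and of every prefix of $D$ lies in $\{ -M,\dots,M\}^n$; throughout $M$ is polynomial in $n$. $\mathcal{D}(n,m)$ is the set of such streams with domain $[n]$ and length at most $m$. A $p$-pass algorithm reads the stream $p$ times in order and may use randomness. For $g:\mathbb{Z}_{\ge0}\to\mathbb{R}$ and $v\in\mathbb{Z}^n$ let $g(v)=\sum_{i=1}^n g(|v_i|)$. The problem $(g,\epsilon)$-SUM is to output $\hat G$ with $P\big((1-\epsilon)g(V(D))\le \hat G\le (1+\epsilon)g(V(D))\big)\ge 2/3$. A function $f:\mathbb{R}_{\ge0}\to\mathbb{R}_{\ge0}$ is sub-polynomial if for every $\alpha>0$, $\lim_{x\to\infty}x^\alpha f(x)=\infty$ and $\lim_{x\to\infty}x^{ -\alpha}f(x)=0$. $g$ is $p$-pass tractable if for every sub-polynomial $h$ and every $\epsilon\ge 1/h(nM)$ there exist a sub-polynomial $h^*$ and a $p$-pass algorithm (with oracle access to $g$) that solves $(g,\epsilon)$-SUM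 for all streams in $\mathcal{D}(n,m)$ and all $n,M\ge1$ using at most $h^*(nM)$ bits of space in the worst case. $\mathcal{G}=\{g:\mathbb{Z}_{\ge0}\to\mathbb{R}: g(0)=0,\ g(1)=1,\ g(x)>0\ \forall x>0\}$. For $g,h\in\mathcal{G}$, $\Theta(g,h)=\sup_{x\in\mathbb{N}}|\log g(x)-\log h(x)|$. For a set $\mathcal{S}$ of functions, $g$ is $\mathcal{S}$-nearly periodic if (1) there is $\alpha>0$ such that for every $N>0$ there exist $x,y\in\mathbb{N}$, $x<y$, $y\ge N$ with $g(y)\le g(x)/y^\alpha$ (such $y$ is called an $\alpha$-period of $g$); and (2) for every $\alpha>0$ and every $h\in\mathcal{S}$ there is $N_1>0$ such that for all $\alpha$-periods $y\ge N_1$ and all $x<y$ with $g(y)y^\alpha\le g(x)$, $|g(x+y)-g(x)|\le \min\{g(x),g(x+y)\}h(y)$. $g$ is $\mathcal{S}$-normal if it is not $\mathcal{S}$-nearly periodic. $\mathbb{S}$ denotes the set of non-increasing sub-polynomial functions on $\mathbb{Z}_{\ge0}$. -}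

module Defs where

open import Algebra.Bundles using (CommutativeRing)
open import Algebra.Structures using (IsCommutativeRing)
import Algebra.Construct.NaturalChoice.Max as Max
import Algebra.Construct.NaturalChoice.Min as Min
import Algebra.Definitions.RawMonoid as RawMonoid
import Algebra.Properties.CommutativeMonoid.Sum as Sum
open import Data.Fin.Base using (Fin)
import Data.Fin.Properties as Fin
open import Data.Integer.Base as ℤ using (ℤ; 0ℤ)
open import Data.List.Base
  using (List; []; _∷_; allFin; cartesianProductWith; concatMap; filter; foldr; length; map; take)
open import Data.Nat.Base as ℕ using (ℕ; zero; suc; NonZero)
open import Data.Bool.Base using (Bool)
open import Data.Product.Base using (Σ; ∃; ∃-syntax; _×_; _,_; proj₁; proj₂)
open import Data.Vec.Base using (Vec; []; _∷_)
open import Function.Base using (id)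
open import Level using (0ℓ)
open import Relation.Binary.Bundles using (DecTotalOrder)
open import Relation.Binary.PropositionalEquality.Core using (_≡_; _≢_)
open import Relation.Binary.Structures using (IsDecTotalOrder)
open import Relation.Nullary.Decidable.Core using (Dec; _×-dec_)
open import Relation.Nullary.Negation.Core using (¬_)

-- The real numbers, given axiomatically as a Dedekind-complete ordered field;
-- such a field is unique up to isomorphism.  The laws `exp-+` and `exp-≥`
-- determine `exp` uniquely as the natural exponential.  `0# ⁻¹` and the values
-- of `log` outside (0,∞) are unspecified.
record Reals : Set₁ where
  infix  8 -_ _⁻¹
  infixl 7 _*_
  infixl 6 _+_
  infix  4 _≤_ _<_
  field
    ℝ       : Set
    _+_ _*_ : ℝ → ℝ → ℝ
    -_ _⁻¹  : ℝ → ℝ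
    0# 1#   : ℝ
    _≤_     : ℝ → ℝ → Set
    exp log : ℝ → ℝ

  _<_ : ℝ → ℝ → Set
  x < y = x ≤ y × x ≢ y

  UpperBound : (ℝ → Set) → ℝ → Set
  UpperBound P b = ∀ x → P x → x ≤ b

  IsSupremum : (ℝ → Set) → ℝ → Set
  IsSupremum P s = UpperBound P s × (∀ b → UpperBound P b → s ≤ b)

  field
    isCommutativeRing : IsCommutativeRing _≡_ _+_ _*_ -_ 0# 1#
    0≢1               : 0# ≢ 1#
    *-inverseʳ        : ∀ {x} → x ≢ 0# → x * x ⁻¹ ≡ 1#
    isDecTotalOrder   : IsDecTotalOrder _≡_ _≤_
    +-monoˡ-≤         : ∀ z {x y} → x ≤ y → x + z ≤ y + z
    *-nonNeg          : ∀ {x y} → 0# ≤ x → 0# ≤ y → 0# ≤ x * y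
    complete          : ∀ P → ∃ P → ∃ (UpperBound P) → ∃ (IsSupremum P)
    exp-+             : ∀ x y → exp (x + y) ≡ exp x * exp y
    exp-≥             : ∀ x → 1# + x ≤ exp x
    exp-log           : ∀ {x} → 0# < x → exp (log x) ≡ x

  commutativeRing : CommutativeRing 0ℓ 0ℓ
  commutativeRing = record { isCommutativeRing = isCommutativeRing }

  decTotalOrder : DecTotalOrder 0ℓ 0ℓ 0ℓ
  decTotalOrder = record { isDecTotalOrder = isDecTotalOrder }

  open CommutativeRing commutativeRing public
    using (_-_; +-rawMonoid; +-commutativeMonoid)
  open DecTotalOrder decTotalOrder public using (_≤?_; totalOrder)
  open Max totalOrder public using (_⊔_)
  open Min totalOrder public using (_⊓_)
  open RawMonoid +-rawMonoid public using () renaming (_×_ to _·_)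
  open Sum +-commutativeMonoid public using (sum)

  infixl 7 _/_
  _/_ : ℝ → ℝ → ℝ
  x / y = x * y ⁻¹

  ∣_∣ : ℝ → ℝ
  ∣ x ∣ = x ⊔ (- x)

  fromℕ : ℕ → ℝ
  fromℕ n = n · 1#

  -- Meaningful for a positive base only.
  infixr 8 _^_
  _^_ : ℝ → ℝ → ℝ
  x ^ α = exp (α * log x)

------------------------------------------------------------------------
-- Streams

Update : ℕ → Set
Update n = Fin n × ℤ

Stream : ℕ → Set
Stream n = List (Update n)

frequency : ∀ {n} → Stream n → Fin n → ℤ
frequency D i = foldr ℤ._+_ 0ℤ (map proj₂ (filter (λ u → proj₁ u Fin.≟ i) D))

-- The turnstile streams 𝒟(n,m) with frequency bound M.  Taking k = length D,
-- the bound applies to D itself.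
𝒟 : (n m M : ℕ) → Stream n → Set
𝒟 n m M D =
  length D ℕ.≤ m × (∀ k i → ℤ.∣ frequency (take k D) i ∣ ℕ.≤ M)

passes : ∀ {n} p → Stream n → List (Fin p × Update n)
passes p D = concatMap (λ j → map (j ,_) D) (allFin p)

tuples : ∀ c k → List (Vec (Fin c) k)
tuples c zero    = [] ∷ []
tuples c (suc k) = cartesianProductWith _∷_ (allFin c) (tuples c k)

module Streaming (R : Reals) where
  open Reals R

  -- A randomized p-pass algorithm for one choice of the parameters: between
  -- updates it retains `space` bits and nothing else.  Initialization, each
  -- update and the output each use a fresh, independent, uniform element of
  -- Fin draws (draws = 2 ^ k amounts to k fair coins); random values needed
  -- later have to be kept in the memory.  The maps are arbitrary, so they may
  -- depend on g, which covers oracle access.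
  record Algorithm (p n : ℕ) : Set where
    field
      space draws   : ℕ
      {{draws≢0}}   : NonZero draws

    Memory : Set
    Memory = Vec Bool space

    field
      start  : Fin draws → Memory
      step   : Fin p → Fin draws → Update n → Memory → Memory
      output : Fin draws → Memory → ℝ

    process : (us : List (Fin p × Update n)) → Vec (Fin draws) (length us) → Memory → Memory
    process []             []      s = s
    process ((j , u) ∷ us) (r ∷ ρ) s = process us ρ (step j r u s)

    Randomness : Stream n → Set
    Randomness D = Vec (Fin draws) (suc (suc (length (passes p D))))

    result : (D : Stream n) → Randomness D → ℝ
    result D (r₀ ∷ r₁ ∷ ρ) = output r₁ (process (passes p D) ρ (start r₀))

  g-sum : ∀ {n} → (ℕ → ℝ) → (Fin n → ℤ) → ℝ
  g-sum g v = sum (λ i → g ℤ.∣ v i ∣)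

  module _ {p n : ℕ} (g : ℕ → ℝ) (ε : ℝ) (A : Algorithm p n) (D : Stream n) where
    open Algorithm A

    Accurate : Randomness D → Set
    Accurate ρ =
      (1# - ε) * g-sum g (frequency D) ≤ result D ρ ×
      result D ρ ≤ (1# + ε) * g-sum g (frequency D)

    accurate? : ∀ ρ → Dec (Accurate ρ)
    accurate? ρ = (_ ≤? _) ×-dec (_ ≤? _)

    -- Accuracy has probability at least 2/3.
    SolvesSum : Set
    SolvesSum = 2 ℕ.* length outcomes ℕ.≤ 3 ℕ.* length (filter accurate? outcomes)
      where outcomes = tuples draws (suc (suc (length (passes p D))))

  ----------------------------------------------------------------------
  -- Sub-polynomial functions

  -- Functions on ℝ≥0 are represented by functions on ℝ whose values at negative
  -- arguments are ignored.  The embedding ι : X → ℝ allows the same definition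
  -- to be used for the domains ℝ≥0 (ι = id) and ℤ≥0 (ι = fromℕ).
  module _ {X : Set} (ι : X → ℝ) where

    TendsTo∞ : (X → ℝ) → Set
    TendsTo∞ F = ∀ B → ∃[ b ] ∀ x → b ≤ ι x → B ≤ F x

    TendsTo0 : (X → ℝ) → Set
    TendsTo0 F = ∀ η → 0# < η → ∃[ b ] ∀ x → b ≤ ι x → ∣ F x ∣ < η

    SubPolynomialOn : (X → ℝ) → Set
    SubPolynomialOn f =
      (∀ x → 0# ≤ ι x → 0# ≤ f x) ×
      (∀ α → 0# < α → TendsTo∞ (λ x → ι x ^ α * f x) × TendsTo0 (λ x → ι x ^ (- α) * f x))

  SubPolynomial : (ℝ → ℝ) → Set
  SubPolynomial = SubPolynomialOn id

  𝕊 : (ℕ → ℝ) → Set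
  𝕊 f = (∀ {x y} → x ℕ.≤ y → f y ≤ f x) × SubPolynomialOn fromℕ f

  ----------------------------------------------------------------------
  -- Tractability

  -- The accuracy ε may vary with n and M.  The condition 0 < h(nM) makes
  -- 1/h(nM) meaningful (where h(nM) = 0, no ε is admissible).
  Admissible : (ℝ → ℝ) → (ℕ → ℕ → ℝ) → Set
  Admissible h ε = ∀ n M → 1 ℕ.≤ n → 1 ℕ.≤ M →
    0# < h (fromℕ (n ℕ.* M)) × 1# / h (fromℕ (n ℕ.* M)) ≤ ε n M

  -- The algorithm is told n, m and M; its space bound must not depend on m.
  Tractable : ℕ → (ℕ → ℝ) → Set
  Tractable p g =
    ∀ h → SubPolynomial h → ∀ ε → Admissible h ε →
    ∃[ h* ] SubPolynomial h* ×
    Σ ((n m M : ℕ) → Algorithm p n) λ A →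
    ∀ n m M → 1 ℕ.≤ n → 1 ℕ.≤ M →
    fromℕ (Algorithm.space (A n m M)) ≤ h* (fromℕ (n ℕ.* M)) ×
    (∀ D → 𝒟 n m M D → SolvesSum g (ε n M) (A n m M) D)

  ----------------------------------------------------------------------
  -- The class 𝒢 and nearly periodic functions

  𝒢 : (ℕ → ℝ) → Set
  𝒢 g = g 0 ≡ 0# × g 1 ≡ 1# × (∀ x → 0 ℕ.< x → 0# < g x)

  LogDistance : (g h : ℕ → ℝ) → ℝ → Set
  LogDistance g h r = ∃[ x ] 1 ℕ.≤ x × r ≡ ∣ log (g x) - log (h x) ∣

  -- Θ(g,h) may be infinite, so it is given as a relation; the natural numbers
  -- in the supremum are the positive ones, since log g(0) is undefined.
  Θ[_,_]≡_ : (g h : ℕ → ℝ) → ℝ → Set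
  Θ[ g , h ]≡ θ = IsSupremum (LogDistance g h) θ

  IsPeriod : ℝ → (ℕ → ℝ) → ℕ → Set
  IsPeriod α g y = ∃[ x ] x ℕ.< y × g y ≤ g x / fromℕ y ^ α

  NearlyPeriodic : ((ℕ → ℝ) → Set) → (ℕ → ℝ) → Set
  NearlyPeriodic 𝒮 g =
    (∃[ α ] 0# < α × (∀ N → 0 ℕ.< N → ∃[ y ] N ℕ.≤ y × IsPeriod α g y)) ×
    (∀ α → 0# < α → ∀ h → 𝒮 h →
     ∃[ N₁ ] 0 ℕ.< N₁ ×
     (∀ y → N₁ ℕ.≤ y → IsPeriod α g y →
      ∀ x → x ℕ.< y → g y * fromℕ y ^ α ≤ g x →
      ∣ g (x ℕ.+ y) - g x ∣ ≤ (g x ⊓ g (x ℕ.+ y)) * h y))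

  Normal : ((ℕ → ℝ) → Set) → (ℕ → ℝ) → Set
  Normal 𝒮 g = ¬ NearlyPeriodic 𝒮 g

{-# OPTIONS --safe #-}
module Submission where

-- Let α be an exponent for which g has arbitrarily large α-periods, and let
-- r = exp (δ / 2).  By recursion on z, h z is g z or r² g z, where for some
-- decomposition z = x + y with g y · y ^ α ≤ g x (if there is one) the factor is
-- chosen so that h x and h z differ at least by the factor r.  Such gaps at
-- unboundedly large periods y contradict near periodicity of h.  They also make a
-- 1-pass algorithm for h solve the INDEX problem: Alice gives each element of her
-- set A ⊆ [n] the frequency y, Bob adds x at b, and as long as n · h y is small
-- compared with h x, the sum reveals whether b ∈ A (h (x + y) or h x).
--
-- INDEX needs linear memory: a decoder that is right with probability 2/3 agrees
-- with A in 2n/3 places on average, so 2 ^ agreement is at least 2 ^ (2n/3) on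
-- average, while for each of the 2 ^ s memory states its sum over all A is 3 ^ n.
-- With n = 15k this gives s ≥ k.  Taking k about y ^ (1/q) makes n M polynomial
-- in k, so no sub-polynomial space bound in n M is possible.

open import Defs
open import Algebra.Bundles using (CommutativeRing)
import Algebra.Construct.NaturalChoice.Max as Max
import Algebra.Construct.NaturalChoice.Min as Min
import Algebra.Properties.Ring as RingProperties
import Algebra.Properties.Semiring.Mult as Mult
import Algebra.Solver.Ring.NaturalCoefficients.Default as Solver
open import Axiom.ExcludedMiddle using (ExcludedMiddle)
open import Data.Bool.Base using (Bool; true; false; if_then_else_; not)
open import Data.Fin.Base using (Fin; zero; suc)
import Data.Fin.Properties as Fin
open import Data.Integer.Base as ℤ using (ℤ)
open import Data.List.Base using (List; []; _∷_; _++_; allFin; drop; filter; length; map; take)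
open import Data.List.Properties using (++-identityʳ; length-map; length-++; length-tabulate; map-++; map-tabulate; take-map)
open import Data.List.Membership.Propositional using (_∈_)
open import Data.List.Membership.Propositional.Properties using (∈-++⁺ˡ; ∈-++⁺ʳ; ∈-map⁺; ∈-allFin; ∈-cartesianProductWith⁺)
open import Data.List.Relation.Unary.Any using (here; there)
open import Data.Nat.Base as ℕ using (ℕ; zero; suc; NonZero; z≤n; s≤s)
import Data.Nat.Induction as ℕ
import Data.Nat.Properties as ℕ
open import Data.Nat.Tactic.RingSolver using (solve-∀)
open import Data.Product.Base using (∃-syntax; _×_; _,_; proj₁; proj₂)
open import Data.Sum.Base using (_⊎_; inj₁; inj₂)
open import Data.Vec.Base as Vec using (Vec; []; _∷_; lookup)
open import Function.Base using (_∘_; id)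
open import Induction.WellFounded using (module All; module FixPoint)
open import Level using (0ℓ)
open import Relation.Binary.Bundles using (DecTotalOrder)
open import Relation.Binary.PropositionalEquality
import Relation.Binary.Reasoning.PartialOrder as PartialOrderReasoning
open import Relation.Nullary.Decidable using (Dec; yes; no; does; dec-true; dec-false)
open import Relation.Nullary.Negation.Core using (¬_; contradiction)
open import Relation.Unary using (Pred; Decidable)

-- The INDEX problem

module Counting where
  open import Data.Nat.Base
  open import Data.Nat.Properties

  private variable
    X Y : Set

  -- Finite sums of natural numbers

  ∑ : List X → (X → ℕ) → ℕ
  ∑ []       f = 0
  ∑ (x ∷ xs) f = f x + ∑ xs f

  ∑-mono : ∀ (xs : List X) {f g : X → ℕ} → (∀ x → f x ≤ g x) → ∑ xs f ≤ ∑ xs g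
  ∑-mono []       f≤g = z≤n
  ∑-mono (x ∷ xs) f≤g = +-mono-≤ (f≤g x) (∑-mono xs f≤g)

  ∑-cong : ∀ (xs : List X) {f g : X → ℕ} → (∀ x → f x ≡ g x) → ∑ xs f ≡ ∑ xs g
  ∑-cong []       f≡g = refl
  ∑-cong (x ∷ xs) f≡g = cong₂ _+_ (f≡g x) (∑-cong xs f≡g)

  interchange : ∀ a b c d → (a + b) + (c + d) ≡ (a + c) + (b + d)
  interchange = solve-∀

  ∑-+ : ∀ (xs : List X) (f g : X → ℕ) → ∑ xs (λ x → f x + g x) ≡ ∑ xs f + ∑ xs g
  ∑-+ []       f g = refl
  ∑-+ (x ∷ xs) f g = trans (cong (f x + g x +_) (∑-+ xs f g)) (interchange (f x) (g x) _ _)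

  ∑-* : ∀ (xs : List X) c (f : X → ℕ) → ∑ xs (λ x → c * f x) ≡ c * ∑ xs f
  ∑-* []       c f = sym (*-zeroʳ c)
  ∑-* (x ∷ xs) c f = trans (cong (c * f x +_) (∑-* xs c f)) (sym (*-distribˡ-+ c _ _))

  ∑-const : ∀ (xs : List X) c → ∑ xs (λ _ → c) ≡ length xs * c
  ∑-const []       c = refl
  ∑-const (x ∷ xs) c = cong (c +_) (∑-const xs c)

  ∑-swap : ∀ (xs : List X) (ys : List Y) (f : X → Y → ℕ) →
    ∑ xs (λ x → ∑ ys (f x)) ≡ ∑ ys (λ y → ∑ xs (λ x → f x y))
  ∑-swap []       ys f = sym (trans (∑-const ys 0) (*-zeroʳ (length ys)))
  ∑-swap (x ∷ xs) ys f =
    trans (cong (∑ ys (f x) +_) (∑-swap xs ys f)) (sym (∑-+ ys (f x) _))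

  ∑-++ : ∀ (xs ys : List X) (f : X → ℕ) → ∑ (xs ++ ys) f ≡ ∑ xs f + ∑ ys f
  ∑-++ []       ys f = refl
  ∑-++ (x ∷ xs) ys f = trans (cong (f x +_) (∑-++ xs ys f)) (sym (+-assoc (f x) _ _))

  ∑-map : ∀ (xs : List X) (h : X → Y) (f : Y → ℕ) → ∑ (map h xs) f ≡ ∑ xs (f ∘ h)
  ∑-map []       h f = refl
  ∑-map (x ∷ xs) h f = cong (f (h x) +_) (∑-map xs h f)

  ∈⇒≤∑ : ∀ {xs : List X} {x} (f : X → ℕ) → x ∈ xs → f x ≤ ∑ xs f
  ∈⇒≤∑ f (here refl) = m≤m+n _ _
  ∈⇒≤∑ f (there x∈)  = ≤-trans (∈⇒≤∑ f x∈) (m≤n+m _ _)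

  ∑-allFin-suc : ∀ {n} (f : Fin (suc n) → ℕ) →
    ∑ (allFin (suc n)) f ≡ f zero + ∑ (allFin n) (f ∘ suc)
  ∑-allFin-suc {n} f = cong (f zero +_)
    (trans (cong (λ l → ∑ l f) (sym (map-tabulate id suc))) (∑-map (allFin n) suc f))

  -- Bit strings and their agreement with a guess

  matches : Bool → Bool → ℕ
  matches true  true  = 1
  matches false false = 1
  matches _     _     = 0

  matches-≡ : ∀ {a b} → a ≡ b → matches a b ≡ 1
  matches-≡ {true}  refl = refl
  matches-≡ {false} refl = refl

  -- Success probabilities are stated with `filter`; bounding them by sums allows the order of
  -- summation to be exchanged.
  length-filter≤∑ : ∀ {P : Pred X 0ℓ} (P? : Decidable P) (f : X → ℕ) →
    (∀ {x} → P x → f x ≡ 1) → ∀ xs → length (filter P? xs) ≤ ∑ xs f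
  length-filter≤∑ P? f P⇒1 []       = z≤n
  length-filter≤∑ P? f P⇒1 (x ∷ xs) with P? x
  ... | yes Px rewrite P⇒1 Px = s≤s (length-filter≤∑ P? f P⇒1 xs)
  ... | no  _  = ≤-trans (length-filter≤∑ P? f P⇒1 xs) (m≤n+m _ (f x))

  strings : ∀ n → List (Vec Bool n)
  strings zero    = [] ∷ []
  strings (suc n) = map (true ∷_) (strings n) ++ map (false ∷_) (strings n)

  ∈-strings : ∀ {n} (A : Vec Bool n) → A ∈ strings n
  ∈-strings []          = here refl
  ∈-strings (true  ∷ A) = ∈-++⁺ˡ (∈-map⁺ (true ∷_) (∈-strings A))
  ∈-strings (false ∷ A) = ∈-++⁺ʳ (map (true ∷_) (strings _)) (∈-map⁺ (false ∷_) (∈-strings A))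

  ∑-strings-suc : ∀ {n} (f : Vec Bool (suc n) → ℕ) →
    ∑ (strings (suc n)) f ≡ ∑ (strings n) (f ∘ (true ∷_)) + ∑ (strings n) (f ∘ (false ∷_))
  ∑-strings-suc {n} f = trans (∑-++ (map (true ∷_) (strings n)) _ f)
    (cong₂ _+_ (∑-map (strings n) (true ∷_) f) (∑-map (strings n) (false ∷_) f))

  length-strings : ∀ n → length (strings n) ≡ 2 ^ n
  length-strings zero    = refl
  length-strings (suc n) = trans (length-++ (map (true ∷_) (strings n)))
    (cong₂ _+_ (trans (length-map _ (strings n)) (length-strings n))
      (trans (trans (length-map _ (strings n)) (length-strings n)) (sym (+-identityʳ _))))

  agreement : ∀ {n} → Vec Bool n → (Fin n → Bool) → ℕ
  agreement {n} A d = ∑ (allFin n) (λ b → matches (d b) (lookup A b))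

  -- The coordinates are independent: whatever `d` says at one of them, its two possible bits
  -- contribute 2 + 1 = 3.
  ∑-2^agreement : ∀ n (d : Fin n → Bool) → ∑ (strings n) (λ A → 2 ^ agreement A d) ≡ 3 ^ n
  ∑-2^agreement zero    d = refl
  ∑-2^agreement (suc n) d = begin
    ∑ (strings (suc n)) (λ A → 2 ^ agreement A d)
      ≡⟨ ∑-strings-suc (λ A → 2 ^ agreement A d) ⟩
    ∑ (strings n) (λ A → 2 ^ agreement (true ∷ A) d) + ∑ (strings n) (λ A → 2 ^ agreement (false ∷ A) d)
      ≡⟨ cong₂ _+_ (head true) (head false) ⟩
    2 ^ matches (d zero) true * 3 ^ n + 2 ^ matches (d zero) false * 3 ^ n
      ≡⟨ split (d zero) ⟩
    3 ^ suc n ∎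
    where
    open ≡-Reasoning
    tail : Fin n → Bool
    tail = d ∘ suc
    head : ∀ a → ∑ (strings n) (λ A → 2 ^ agreement (a ∷ A) d) ≡ 2 ^ matches (d zero) a * 3 ^ n
    head a = begin
      ∑ (strings n) (λ A → 2 ^ agreement (a ∷ A) d)
        ≡⟨ ∑-cong (strings n) (λ A → trans
             (cong (2 ^_) (∑-allFin-suc (λ b → matches (d b) (lookup (a ∷ A) b))))
             (^-distribˡ-+-* 2 (matches (d zero) a) (agreement A tail))) ⟩
      ∑ (strings n) (λ A → 2 ^ matches (d zero) a * 2 ^ agreement A tail)
        ≡⟨ ∑-* (strings n) (2 ^ matches (d zero) a) _ ⟩
      2 ^ matches (d zero) a * ∑ (strings n) (λ A → 2 ^ agreement A tail)
        ≡⟨ cong (2 ^ matches (d zero) a *_) (∑-2^agreement n tail) ⟩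
      2 ^ matches (d zero) a * 3 ^ n ∎
    split : ∀ a → 2 ^ matches a true * 3 ^ n + 2 ^ matches a false * 3 ^ n ≡ 3 ^ suc n
    split true  = two+one (3 ^ n)
      where
      two+one : ∀ t → 2 * t + 1 * t ≡ 3 * t
      two+one = solve-∀
    split false = one+two (3 ^ n)
      where
      one+two : ∀ t → 1 * t + 2 * t ≡ 3 * t
      one+two = solve-∀

  suc≤2^ : ∀ j → suc j ≤ 2 ^ j
  suc≤2^ zero    = ≤-refl
  suc≤2^ (suc j) = begin
    1 + suc j           ≤⟨ +-mono-≤ (m^n>0 2 j) (suc≤2^ j) ⟩
    2 ^ j + 2 ^ j       ≡⟨ cong (2 ^ j +_) (+-identityʳ _) ⟨
    2 ^ suc j           ∎
    where open ≤-Reasoning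

  -- The tangent inequality 1 + (a − k) ≤ 2 ^ (a − k), scaled by 2 ^ k so that it
  -- holds without subtraction.
  2^-tangent : ∀ k a → 2 ^ k * suc a ≤ 2 ^ a + 2 ^ k * k
  2^-tangent k a with k ≤? a
  ... | no k≰a  = ≤-trans (*-monoʳ-≤ (2 ^ k) (≰⇒> k≰a)) (m≤n+m _ (2 ^ a))
  ... | yes k≤a = begin
    2 ^ k * suc a                     ≡⟨ cong (λ z → 2 ^ k * suc z) (m∸n+n≡m k≤a) ⟨
    2 ^ k * (suc (a ∸ k) + k)         ≡⟨ *-distribˡ-+ (2 ^ k) (suc (a ∸ k)) k ⟩
    2 ^ k * suc (a ∸ k) + 2 ^ k * k   ≤⟨ +-monoˡ-≤ (2 ^ k * k) (*-monoʳ-≤ (2 ^ k) (suc≤2^ (a ∸ k))) ⟩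
    2 ^ k * 2 ^ (a ∸ k) + 2 ^ k * k   ≡⟨ cong (_+ 2 ^ k * k) (^-distribˡ-+-* 2 k (a ∸ k)) ⟨
    2 ^ (k + (a ∸ k)) + 2 ^ k * k     ≡⟨ cong (λ z → 2 ^ z + 2 ^ k * k) (m+[n∸m]≡n k≤a) ⟩
    2 ^ a + 2 ^ k * k                 ∎
    where open ≤-Reasoning

  -- A one-way INDEX protocol with public coins: both parties see `ρ`, and only the `s` bits pass
  -- between them. The length `3 * m` makes two thirds of it the integer `2 * m`.
  module Index {Rnd : Set} (Rs : List Rnd) {{Rs≢[] : NonZero (length Rs)}} (m s : ℕ)
    (encode : Rnd → Vec Bool (3 * m) → Vec Bool s)
    (decode : Rnd → Vec Bool s → Fin (3 * m) → Bool)
    (correct : ∀ A b →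
      2 * length Rs ≤ 3 * ∑ Rs (λ ρ → matches (decode ρ (encode ρ A) b) (lookup A b)))
    where

    private
      n R N K : ℕ
      n = 3 * m
      R = length Rs
      N = 2 ^ n
      K = 2 ^ (2 * m)

      agreed : Rnd → Vec Bool n → ℕ
      agreed ρ A = agreement A (decode ρ (encode ρ A))

      ∑∑ : (Rnd → Vec Bool n → ℕ) → ℕ
      ∑∑ f = ∑ Rs (λ ρ → ∑ (strings n) (f ρ))

      ∑∑-const : ∀ c → ∑∑ (λ _ _ → c) ≡ R * (N * c)
      ∑∑-const c = trans (∑-const Rs _)
        (cong (R *_) (trans (∑-const (strings n) c) (cong (_* c) (length-strings n))))

      -- Summing over all memory states instead of the one that occurs makes the
      -- sum over the strings explicit.
      2^agreed-upper : ∑∑ (λ ρ A → 2 ^ agreed ρ A) ≤ R * (2 ^ s * 3 ^ n)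
      2^agreed-upper = begin
        ∑∑ (λ ρ A → 2 ^ agreed ρ A)
          ≤⟨ ∑-mono Rs (λ ρ → begin
               ∑ (strings n) (λ A → 2 ^ agreed ρ A)
                 ≤⟨ ∑-mono (strings n) (λ A →
                      ∈⇒≤∑ (λ σ → 2 ^ agreement A (decode ρ σ)) (∈-strings (encode ρ A))) ⟩
               ∑ (strings n) (λ A → ∑ (strings s) (λ σ → 2 ^ agreement A (decode ρ σ)))
                 ≡⟨ ∑-swap (strings n) (strings s) _ ⟩
               ∑ (strings s) (λ σ → ∑ (strings n) (λ A → 2 ^ agreement A (decode ρ σ)))
                 ≡⟨ ∑-cong (strings s) (λ σ → ∑-2^agreement n (decode ρ σ)) ⟩
               ∑ (strings s) (λ _ → 3 ^ n)
                 ≡⟨ ∑-const (strings s) _ ⟩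
               length (strings s) * 3 ^ n
                 ≡⟨ cong (_* 3 ^ n) (length-strings s) ⟩
               2 ^ s * 3 ^ n ∎) ⟩
        ∑ Rs (λ _ → 2 ^ s * 3 ^ n)
          ≡⟨ ∑-const Rs _ ⟩
        R * (2 ^ s * 3 ^ n) ∎
        where open ≤-Reasoning

      -- Linearity of expectation: each of the `3 * m` positions is guessed with probability at
      -- least 2/3. The factor 3 clears the denominator.
      agreed-lower : R * (N * (2 * m)) ≤ ∑∑ agreed
      agreed-lower = *-cancelˡ-≤ 3 (begin
        3 * (R * (N * (2 * m)))
          ≡⟨ rearrange R N m ⟩
        N * (3 * m * (2 * R))
          ≡⟨ cong₂ _*_ (sym (length-strings n)) (cong (_* (2 * R)) (sym (length-tabulate {n = n} id))) ⟩
        length (strings n) * (length (allFin n) * (2 * R))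
          ≡⟨ cong (length (strings n) *_) (∑-const (allFin n) (2 * R)) ⟨
        length (strings n) * ∑ (allFin n) (λ _ → 2 * R)
          ≡⟨ ∑-const (strings n) _ ⟨
        ∑ (strings n) (λ _ → ∑ (allFin n) (λ _ → 2 * R))
          ≤⟨ ∑-mono (strings n) (λ A → ∑-mono (allFin n) (correct A)) ⟩
        ∑ (strings n) (λ A → ∑ (allFin n) (λ b → 3 * ∑ Rs (λ ρ → hit ρ A b)))
          ≡⟨ ∑-cong (strings n) (λ A → ∑-* (allFin n) 3 _) ⟩
        ∑ (strings n) (λ A → 3 * ∑ (allFin n) (λ b → ∑ Rs (λ ρ → hit ρ A b)))
          ≡⟨ ∑-* (strings n) 3 _ ⟩
        3 * ∑ (strings n) (λ A → ∑ (allFin n) (λ b → ∑ Rs (λ ρ → hit ρ A b)))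
          ≡⟨ cong (3 *_) (∑-cong (strings n) (λ A → ∑-swap (allFin n) Rs _)) ⟩
        3 * ∑ (strings n) (λ A → ∑ Rs (λ ρ → agreed ρ A))
          ≡⟨ cong (3 *_) (∑-swap (strings n) Rs _) ⟩
        3 * ∑∑ agreed ∎)
        where
        open ≤-Reasoning
        hit : Rnd → Vec Bool n → Fin n → ℕ
        hit ρ A b = matches (decode ρ (encode ρ A) b) (lookup A b)
        rearrange : ∀ R N m → 3 * (R * (N * (2 * m))) ≡ N * (3 * m * (2 * R))
        rearrange = solve-∀

    -- Jensen's inequality for 2 ^ a by means of its tangent at a = `2 * m`: as the mean of `agreed`
    -- is at least `2 * m`, the mean of 2 ^ `agreed` is at least `K`, and `2^agreed-upper` bounds it
    -- from above.
    2^[2m]*2^n≤2^s*3^n : K * N ≤ 2 ^ s * 3 ^ n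
    -- The summand added on both sides is the total of the terms `K * (2 * m)` on the right of the
    -- tangent inequality.
    2^[2m]*2^n≤2^s*3^n = *-cancelˡ-≤ R (+-cancelʳ-≤ (R * (N * (K * (2 * m)))) _ _ (begin
      R * (K * N) + R * (N * (K * (2 * m)))
        ≡⟨ rearrange R K N (2 * m) ⟩
      K * (R * (N * 1) + R * (N * (2 * m)))
        ≤⟨ *-monoʳ-≤ K (+-monoʳ-≤ (R * (N * 1)) agreed-lower) ⟩
      K * (R * (N * 1) + ∑∑ agreed)
        ≡⟨ cong (λ z → K * (z + ∑∑ agreed)) (∑∑-const 1) ⟨
      K * (∑∑ (λ _ _ → 1) + ∑∑ agreed)
        ≡⟨ cong (K *_) (∑∑-+ (λ _ _ → 1) agreed) ⟨
      K * ∑∑ (λ ρ A → suc (agreed ρ A))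
        ≡⟨ trans (∑-cong Rs (λ ρ → ∑-* (strings n) K _)) (∑-* Rs K _) ⟨
      ∑∑ (λ ρ A → K * suc (agreed ρ A))
        ≤⟨ ∑-mono Rs (λ ρ → ∑-mono (strings n) (λ A → 2^-tangent (2 * m) (agreed ρ A))) ⟩
      ∑∑ (λ ρ A → 2 ^ agreed ρ A + K * (2 * m))
        ≡⟨ ∑∑-+ (λ ρ A → 2 ^ agreed ρ A) (λ _ _ → K * (2 * m)) ⟩
      ∑∑ (λ ρ A → 2 ^ agreed ρ A) + ∑∑ (λ _ _ → K * (2 * m))
        ≤⟨ +-mono-≤ 2^agreed-upper (≤-reflexive (∑∑-const (K * (2 * m)))) ⟩
      R * (2 ^ s * 3 ^ n) + R * (N * (K * (2 * m))) ∎))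
      where
      open ≤-Reasoning
      rearrange : ∀ R K N l → R * (K * N) + R * (N * (K * l)) ≡ K * (R * (N * 1) + R * (N * l))
      rearrange = solve-∀
      ∑∑-+ : ∀ f g → ∑∑ (λ ρ A → f ρ A + g ρ A) ≡ ∑∑ f + ∑∑ g
      ∑∑-+ f g = trans (∑-cong Rs (λ ρ → ∑-+ (strings n) (f ρ) (g ρ))) (∑-+ Rs _ _)

  ^-distribʳ-* : ∀ k a b → (a * b) ^ k ≡ a ^ k * b ^ k
  ^-distribʳ-* zero    a b = refl
  ^-distribʳ-* (suc k) a b =
    trans (cong (a * b *_) (^-distribʳ-* k a b)) (rearrange a b (a ^ k) (b ^ k))
    where
    rearrange : ∀ a b u v → a * b * (u * v) ≡ (a * u) * (b * v)
    rearrange = solve-∀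

  -- The constants are 3 ^ 15, 2 · 3 ^ 15 and 2 ^ 25.
  index-space-bound : ∀ k s → 2 ^ (2 * (5 * k)) * 2 ^ (3 * (5 * k)) ≤ 2 ^ s * 3 ^ (3 * (5 * k)) → k ≤ s
  index-space-bound k s bound = ≮⇒≥ λ s<k → <⇒≱ (^-monoʳ-< 2 (s≤s (s≤s z≤n)) s<k)
    (*-cancelʳ-≤ (2 ^ k) (2 ^ s) (14348907 ^ k) {{m^n≢0 14348907 k}} (begin
      2 ^ k * 14348907 ^ k                   ≡⟨ ^-distribʳ-* k 2 14348907 ⟨
      -- This margin explains the length `3 * (5 * k)`: each unit of m gains 5 - 3 log₂ 3, about
      -- 0.245 bits, so five units gain more than one bit.
      28697814 ^ k                           ≤⟨ ^-monoˡ-≤ k (≤ᵇ⇒≤ 28697814 33554432 _) ⟩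
      33554432 ^ k                           ≡⟨ ^-*-assoc 2 25 k ⟩
      2 ^ (25 * k)                           ≡⟨ cong (2 ^_) (25k k) ⟩
      2 ^ (2 * (5 * k) + 3 * (5 * k))        ≡⟨ ^-distribˡ-+-* 2 (2 * (5 * k)) (3 * (5 * k)) ⟩
      2 ^ (2 * (5 * k)) * 2 ^ (3 * (5 * k))  ≤⟨ bound ⟩
      2 ^ s * 3 ^ (3 * (5 * k))              ≡⟨ cong (λ e → 2 ^ s * 3 ^ e) (15k k) ⟩
      2 ^ s * 3 ^ (15 * k)                   ≡⟨ cong (2 ^ s *_) (^-*-assoc 3 15 k) ⟨
      2 ^ s * 14348907 ^ k                   ∎))
    where
    open ≤-Reasoning
    25k : ∀ k → 25 * k ≡ 2 * (5 * k) + 3 * (5 * k)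
    25k = solve-∀
    15k : ∀ k → 3 * (5 * k) ≡ 15 * k
    15k = solve-∀

  -- Induction on `y`: the root grows by at most one at each step, because `y < suc k ^ q` means
  -- `suc y ≤ suc k ^ q`, which is below the next power.
  floor-root : ∀ q .{{_ : NonZero q}} y → ∃[ k ] k ^ q ≤ y × y < suc k ^ q
  floor-root (suc q) zero = 0 , z≤n , m^n>0 1 (suc q)
  floor-root q (suc y) with floor-root q y
  ... | k , k^q≤y , y<[1+k]^q with suc k ^ q ≤? suc y
  ... | no  ≰1+y = k , m≤n⇒m≤1+n k^q≤y , ≰⇒> ≰1+y
  ... | yes ≤1+y = suc k , ≤1+y ,
    ≤-<-trans y<[1+k]^q (^-monoˡ-< q ≤-refl)

open Counting

-- Real numbers

module RealProperties (R : Reals) where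
  open Reals R
  open CommutativeRing commutativeRing public
    using (+-comm; +-assoc; +-identityˡ; +-identityʳ; -‿inverseˡ; -‿inverseʳ;
           *-comm; *-assoc; *-identityˡ; *-identityʳ; distribˡ; distribʳ; zeroˡ; zeroʳ)
  open CommutativeRing commutativeRing using (ring; semiring; commutativeSemiring)
  open RingProperties ring public
    using (-‿distribˡ-*; -‿distribʳ-*; -‿involutive; -0#≈0#; -‿+-comm)
  open DecTotalOrder decTotalOrder public using ()
    renaming (refl to ≤-refl; trans to ≤-trans; reflexive to ≤-reflexive;
              antisym to ≤-antisym; total to ≤-total)
  module ≤-Reasoning = PartialOrderReasoning (DecTotalOrder.poset decTotalOrder)
  open Solver commutativeSemiring public using (solve; _:=_; _:*_)
  open ≤-Reasoning

  <⇒≱ : ∀ {x y} → x < y → ¬ (y ≤ x)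
  <⇒≱ (x≤y , x≢y) y≤x = x≢y (≤-antisym x≤y y≤x)

  ≰⇒> : ∀ {x y} → ¬ (x ≤ y) → y < x
  ≰⇒> {x} {y} x≰y with ≤-total x y
  ... | inj₁ x≤y = contradiction x≤y x≰y
  ... | inj₂ y≤x = y≤x , λ y≡x → x≰y (≤-reflexive (sym y≡x))

  <-≤-trans : ∀ {x y z} → x < y → y ≤ z → x < z
  <-≤-trans {x} {y} {z} x<y y≤z = begin-strict x <⟨ x<y ⟩ y ≤⟨ y≤z ⟩ z ∎

  ≤-<-trans : ∀ {x y z} → x ≤ y → y < z → x < z
  ≤-<-trans {x} {y} {z} x≤y y<z = begin-strict x ≤⟨ x≤y ⟩ y <⟨ y<z ⟩ z ∎

  +-monoʳ-≤ : ∀ z {x y} → x ≤ y → z + x ≤ z + y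
  +-monoʳ-≤ z {x} {y} x≤y = subst₂ _≤_ (+-comm x z) (+-comm y z) (+-monoˡ-≤ z x≤y)

  +-mono-≤ : ∀ {x y u v} → x ≤ y → u ≤ v → x + u ≤ y + v
  +-mono-≤ {y = y} {u = u} x≤y u≤v = ≤-trans (+-monoˡ-≤ u x≤y) (+-monoʳ-≤ y u≤v)

  +-nonNeg : ∀ {x y} → 0# ≤ x → 0# ≤ y → 0# ≤ x + y
  +-nonNeg 0≤x 0≤y = subst (_≤ _) (+-identityˡ 0#) (+-mono-≤ 0≤x 0≤y)

  x+y-y : ∀ x y → x + y + - y ≡ x
  x+y-y x y = trans (+-assoc x y (- y)) (trans (cong (x +_) (-‿inverseʳ y)) (+-identityʳ x))

  x-y+y : ∀ x y → x - y + y ≡ x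
  x-y+y x y = trans (+-assoc x (- y) y) (trans (cong (x +_) (-‿inverseˡ y)) (+-identityʳ x))

  +-cancelʳ-≤ : ∀ z {x y} → x + z ≤ y + z → x ≤ y
  +-cancelʳ-≤ z {x} {y} le = subst₂ _≤_ (x+y-y x z) (x+y-y y z) (+-monoˡ-≤ (- z) le)

  x≤y⇒0≤y-x : ∀ {x y} → x ≤ y → 0# ≤ y - x
  x≤y⇒0≤y-x {x} {y} x≤y = subst (_≤ y - x) (-‿inverseʳ x) (+-monoˡ-≤ (- x) x≤y)

  0≤y-x⇒x≤y : ∀ {x y} → 0# ≤ y - x → x ≤ y
  0≤y-x⇒x≤y {x} {y} le = subst₂ _≤_ (+-identityˡ x) (x-y+y y x) (+-monoˡ-≤ x le)

  x+z≤y⇒z≤y-x : ∀ {x y z} → x + z ≤ y → z ≤ y - x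
  x+z≤y⇒z≤y-x {x} {y} {z} le = +-cancelʳ-≤ x
    (subst₂ _≤_ (+-comm x z) (sym (x-y+y y x)) le)

  neg-antimono-≤ : ∀ {x y} → x ≤ y → - y ≤ - x
  neg-antimono-≤ {x} {y} x≤y = 0≤y-x⇒x≤y
    (subst (0# ≤_) (trans (+-comm y (- x)) (cong (- x +_) (sym (-‿involutive y)))) (x≤y⇒0≤y-x x≤y))

  *-monoʳ-≤ : ∀ {z x y} → 0# ≤ z → x ≤ y → z * x ≤ z * y
  *-monoʳ-≤ {z} {x} {y} 0≤z x≤y = 0≤y-x⇒x≤y (subst (0# ≤_)
    (trans (distribˡ z y (- x)) (cong (z * y +_) (sym (-‿distribʳ-* z x))))
    (*-nonNeg 0≤z (x≤y⇒0≤y-x x≤y)))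

  *-monoˡ-≤ : ∀ {z x y} → 0# ≤ z → x ≤ y → x * z ≤ y * z
  *-monoˡ-≤ {z} {x} {y} 0≤z x≤y =
    subst₂ _≤_ (*-comm z x) (*-comm z y) (*-monoʳ-≤ 0≤z x≤y)

  *-mono-≤ : ∀ {x y u v} → 0# ≤ y → 0# ≤ u → x ≤ y → u ≤ v → x * u ≤ y * v
  *-mono-≤ 0≤y 0≤u x≤y u≤v = ≤-trans (*-monoˡ-≤ 0≤u x≤y) (*-monoʳ-≤ 0≤y u≤v)

  -- Otherwise `- 1#` would be non-negative, and so would its square, which is `1#`.
  0≤1 : 0# ≤ 1#
  0≤1 with ≤-total 0# 1#
  ... | inj₁ 0≤1 = 0≤1
  ... | inj₂ 1≤0 = subst (0# ≤_) -1*-1≡1 (*-nonNeg 0≤-1 0≤-1)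
    where
    0≤-1 : 0# ≤ - 1#
    0≤-1 = subst (_≤ - 1#) -0#≈0# (neg-antimono-≤ 1≤0)
    -1*-1≡1 : - 1# * - 1# ≡ 1#
    -1*-1≡1 = trans (sym (-‿distribˡ-* 1# (- 1#))) (trans (cong -_ (*-identityˡ (- 1#))) (-‿involutive 1#))

  0<1 : 0# < 1#
  0<1 = 0≤1 , 0≢1

  >⇒≢0 : ∀ {x} → 0# < x → x ≢ 0#
  >⇒≢0 (_ , 0≢x) x≡0 = 0≢x (sym x≡0)

  *-inverseˡ : ∀ {x} → x ≢ 0# → x ⁻¹ * x ≡ 1#
  *-inverseˡ {x} x≢0 = trans (*-comm (x ⁻¹) x) (*-inverseʳ x≢0)

  x*y*y⁻¹ : ∀ x {y} → y ≢ 0# → x * y * y ⁻¹ ≡ x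
  x*y*y⁻¹ x y≢0 = trans (*-assoc _ _ _) (trans (cong (x *_) (*-inverseʳ y≢0)) (*-identityʳ x))

  x*y⁻¹*y : ∀ x {y} → y ≢ 0# → x * y ⁻¹ * y ≡ x
  x*y⁻¹*y x y≢0 = trans (*-assoc _ _ _) (trans (cong (x *_) (*-inverseˡ y≢0)) (*-identityʳ x))

  *-cancelʳ-≡ : ∀ {x y z} → z ≢ 0# → x * z ≡ y * z → x ≡ y
  *-cancelʳ-≡ {x} {y} {z} z≢0 eq =
    trans (sym (x*y*y⁻¹ x z≢0)) (trans (cong (_* z ⁻¹) eq) (x*y*y⁻¹ y z≢0))

  *-cancelʳ-≤ : ∀ {x y z} → 0# < z → x * z ≤ y * z → x ≤ y
  *-cancelʳ-≤ {x} {y} {z} 0<z xz≤yz with x ≤? y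
  ... | yes x≤y = x≤y
  ... | no  x≰y = ≤-reflexive (*-cancelʳ-≡ (>⇒≢0 0<z)
    (≤-antisym xz≤yz (*-monoˡ-≤ (proj₁ 0<z) (proj₁ (≰⇒> x≰y)))))

  *-cancelˡ-≤ : ∀ {x y z} → 0# < z → z * x ≤ z * y → x ≤ y
  *-cancelˡ-≤ {x} {y} {z} 0<z zx≤zy =
    *-cancelʳ-≤ 0<z (subst₂ _≤_ (*-comm z x) (*-comm z y) zx≤zy)

  *-monoˡ-< : ∀ {x y z} → 0# < z → x < y → x * z < y * z
  *-monoˡ-< 0<z x<y = ≰⇒> (<⇒≱ x<y ∘ *-cancelʳ-≤ 0<z)

  *-pos : ∀ {x y} → 0# < x → 0# < y → 0# < x * y
  *-pos {x} {y} 0<x 0<y = subst (_< x * y) (zeroˡ y) (*-monoˡ-< 0<y 0<x)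

  *-pos⇒pos : ∀ {x y} → 0# ≤ y → 0# < x * y → 0# < x
  *-pos⇒pos {x} {y} 0≤y 0<xy =
    ≰⇒> (λ x≤0 → <⇒≱ 0<xy (subst (x * y ≤_) (zeroˡ y) (*-monoˡ-≤ 0≤y x≤0)))

  ⁻¹-pos : ∀ {x} → 0# < x → 0# < x ⁻¹
  ⁻¹-pos 0<x = *-pos⇒pos (proj₁ 0<x) (subst (0# <_) (sym (*-inverseˡ (>⇒≢0 0<x))) 0<1)

  1/x⁻¹≡x : ∀ {x} → 0# < x → 1# / x ⁻¹ ≡ x
  1/x⁻¹≡x {x} 0<x = *-cancelʳ-≡ (>⇒≢0 (⁻¹-pos 0<x))
    (trans (x*y⁻¹*y 1# (>⇒≢0 (⁻¹-pos 0<x))) (sym (*-inverseʳ (>⇒≢0 0<x))))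

  x≤y/z⇒x*z≤y : ∀ {x y z} → 0# < z → x ≤ y / z → x * z ≤ y
  x≤y/z⇒x*z≤y {x} {y} {z} 0<z le =
    subst (x * z ≤_) (x*y⁻¹*y y (>⇒≢0 0<z)) (*-monoˡ-≤ (proj₁ 0<z) le)

  x*z≤y⇒x≤y/z : ∀ {x y z} → 0# < z → x * z ≤ y → x ≤ y / z
  x*z≤y⇒x≤y/z {x} {y} {z} 0<z le =
    subst (_≤ y / z) (x*y*y⁻¹ x (>⇒≢0 0<z)) (*-monoˡ-≤ (proj₁ (⁻¹-pos 0<z)) le)

  half : ∀ {x} → 0# < x → ∃[ y ] 0# < y × y + y ≡ x
  half {x} 0<x = x * 2# ⁻¹ , *-pos 0<x (⁻¹-pos 0<2) ,
    trans (sym (distribˡ x _ _)) (trans (cong (x *_) 2⁻¹+2⁻¹≡1) (*-identityʳ x))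
    where
    2# : ℝ
    2# = 1# + 1#
    0<2 : 0# < 2#
    0<2 = <-≤-trans 0<1 (subst (_≤ 2#) (+-identityˡ 1#) (+-monoˡ-≤ 1# 0≤1))
    2⁻¹+2⁻¹≡1 : 2# ⁻¹ + 2# ⁻¹ ≡ 1#
    2⁻¹+2⁻¹≡1 = trans
      (sym (trans (distribʳ (2# ⁻¹) 1# 1#) (cong₂ _+_ (*-identityˡ _) (*-identityˡ _))))
      (*-inverseʳ (>⇒≢0 0<2))

  -- Absolute value and minimum

  open Max totalOrder public
    using (x≤x⊔y; x≤y⊔x; ⊔-lub)
  open Min totalOrder public
    using (x⊓y≤x; x⊓y≤y)

  0≤x⇒∣x∣≡x : ∀ {x} → 0# ≤ x → ∣ x ∣ ≡ x
  0≤x⇒∣x∣≡x {x} 0≤x = ≤-antisym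
    (⊔-lub ≤-refl (≤-trans (subst (- x ≤_) -0#≈0# (neg-antimono-≤ 0≤x)) 0≤x))
    (x≤x⊔y x (- x))

  -- Exponential and logarithm

  exp≥1 : ∀ {x} → 0# ≤ x → 1# ≤ exp x
  exp≥1 {x} 0≤x = ≤-trans (subst (_≤ 1# + x) (+-identityʳ 1#) (+-monoʳ-≤ 1# 0≤x)) (exp-≥ x)

  exp-0 : exp 0# ≡ 1#
  exp-0 = *-cancelʳ-≡ (>⇒≢0 (<-≤-trans 0<1 (exp≥1 ≤-refl)))
    (trans (sym (exp-+ 0# 0#)) (trans (cong exp (+-identityˡ 0#)) (sym (*-identityˡ _))))

  exp-inverse : ∀ x → exp x * exp (- x) ≡ 1#
  exp-inverse x = trans (sym (exp-+ x (- x))) (trans (cong exp (-‿inverseʳ x)) exp-0)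

  -- For x ≤ 0 the value is the reciprocal of `exp (- x)`, which is at least 1.
  exp-pos : ∀ x → 0# < exp x
  exp-pos x with ≤-total 0# x
  ... | inj₁ 0≤x = <-≤-trans 0<1 (exp≥1 0≤x)
  ... | inj₂ x≤0 = *-pos⇒pos (≤-trans 0≤1 (exp≥1 (subst (_≤ - x) -0#≈0# (neg-antimono-≤ x≤0))))
    (subst (0# <_) (sym (exp-inverse x)) 0<1)

  exp-split : ∀ x y → exp y ≡ exp (y - x) * exp x
  exp-split x y = trans (cong exp (sym (x-y+y y x))) (exp-+ (y - x) x)

  exp-mono-≤ : ∀ {x y} → x ≤ y → exp x ≤ exp y
  exp-mono-≤ {x} {y} x≤y = begin
    exp x                ≡⟨ *-identityˡ (exp x) ⟨
    1# * exp x           ≤⟨ *-monoˡ-≤ (proj₁ (exp-pos x)) (exp≥1 (x≤y⇒0≤y-x x≤y)) ⟩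
    exp (y - x) * exp x  ≡⟨ exp-split x y ⟨
    exp y                ∎

  -- `exp-≥` at `x - y`, multiplied by `exp y`, yields 1 + (x - y) ≤ 1.
  exp-cancel-≤ : ∀ {x y} → exp x ≤ exp y → x ≤ y
  exp-cancel-≤ {x} {y} le = 0≤y-x⇒x≤y (+-cancelʳ-≤ 0# (begin
    0# + 0#        ≡⟨ +-identityˡ 0# ⟩
    0#             ≤⟨ x≤y⇒0≤y-x (*-cancelʳ-≤ (exp-pos y) (begin
      (1# + (x - y)) * exp y  ≤⟨ *-monoˡ-≤ (proj₁ (exp-pos y)) (exp-≥ (x - y)) ⟩
      exp (x - y) * exp y     ≡⟨ exp-split y x ⟨
      exp x                   ≤⟨ le ⟩
      exp y                   ≡⟨ *-identityˡ (exp y) ⟨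
      1# * exp y              ∎)) ⟩
    1# - (1# + (x - y))  ≡⟨ cong (1# +_) (sym (-‿+-comm 1# (x - y))) ⟩
    1# + (- 1# - (x - y)) ≡⟨ sym (+-assoc 1# (- 1#) _) ⟩
    1# - 1# - (x - y)     ≡⟨ trans (cong (_- (x - y)) (-‿inverseʳ 1#)) (+-identityˡ _) ⟩
    - (x - y)             ≡⟨ sym (-‿+-comm x (- y)) ⟩
    - x - - y             ≡⟨ trans (cong (- x +_) (-‿involutive y)) (+-comm (- x) y) ⟩
    y - x                 ≡⟨ +-identityʳ (y - x) ⟨
    y - x + 0#            ∎))

  log-exp : ∀ x → log (exp x) ≡ x
  log-exp x = ≤-antisym (exp-cancel-≤ (≤-reflexive eq)) (exp-cancel-≤ (≤-reflexive (sym eq)))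
    where
    eq : exp (log (exp x)) ≡ exp x
    eq = exp-log (exp-pos x)

  log-mono-≤ : ∀ {x y} → 0# < x → x ≤ y → log x ≤ log y
  log-mono-≤ 0<x x≤y = exp-cancel-≤
    (subst₂ _≤_ (sym (exp-log 0<x)) (sym (exp-log (<-≤-trans 0<x x≤y))) x≤y)

  exp≤⇒≤log : ∀ {x y} → exp x ≤ y → x ≤ log y
  exp≤⇒≤log {x} {y} le = subst (_≤ log y) (log-exp x) (log-mono-≤ (exp-pos x) le)

  log-* : ∀ {x y} → 0# < x → 0# < y → log (x * y) ≡ log x + log y
  log-* {x} {y} 0<x 0<y = trans
    (cong log (trans (cong₂ _*_ (sym (exp-log 0<x)) (sym (exp-log 0<y))) (sym (exp-+ _ _))))
    (log-exp _)

  log-1 : log 1# ≡ 0#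
  log-1 = trans (cong log (sym exp-0)) (log-exp 0#)

  ^-pos : ∀ x α → 0# < x ^ α
  ^-pos x α = exp-pos (α * log x)

  ^-+ : ∀ x α β → x ^ (α + β) ≡ x ^ α * x ^ β
  ^-+ x α β = trans (cong exp (distribʳ (log x) α β)) (exp-+ _ _)

  -- The embedding of the natural numbers

  open Mult semiring using (×1-homo-*)

  fromℕ-* : ∀ m n → fromℕ (m ℕ.* n) ≡ fromℕ m * fromℕ n
  fromℕ-* = ×1-homo-*

  fromℕ-nonNeg : ∀ n → 0# ≤ fromℕ n
  fromℕ-nonNeg zero    = ≤-refl
  fromℕ-nonNeg (suc n) = +-nonNeg 0≤1 (fromℕ-nonNeg n)

  fromℕ-mono-≤ : ∀ {m n} → m ℕ.≤ n → fromℕ m ≤ fromℕ n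
  fromℕ-mono-≤ {n = n} ℕ.z≤n       = fromℕ-nonNeg n
  fromℕ-mono-≤         (ℕ.s≤s m≤n) = +-monoʳ-≤ 1# (fromℕ-mono-≤ m≤n)

  fromℕ-pos : ∀ {n} → 1 ℕ.≤ n → 0# < fromℕ n
  fromℕ-pos {n} 1≤n = <-≤-trans 0<1 (subst (_≤ fromℕ n) (+-identityʳ 1#) (fromℕ-mono-≤ 1≤n))

  log-fromℕ-nonNeg : ∀ {n} → 1 ℕ.≤ n → 0# ≤ log (fromℕ n)
  log-fromℕ-nonNeg {n} 1≤n = subst (_≤ log (fromℕ n)) (trans (cong log (+-identityʳ 1#)) log-1)
    (log-mono-≤ (fromℕ-pos {1} ℕ.≤-refl) (fromℕ-mono-≤ 1≤n))

  log-fromℕ-^ : ∀ {k} q → 1 ℕ.≤ k → log (fromℕ (k ℕ.^ q)) ≡ fromℕ q * log (fromℕ k)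
  log-fromℕ-^ zero 1≤k = trans (trans (cong log (+-identityʳ 1#)) log-1) (sym (zeroˡ _))
  log-fromℕ-^ {k@(suc _)} (suc q) 1≤k = trans (cong log (fromℕ-* k (k ℕ.^ q)))
    (trans (log-* (fromℕ-pos 1≤k) (fromℕ-pos (ℕ.m^n>0 k q)))
      (trans (cong₂ _+_ (sym (*-identityˡ _)) (log-fromℕ-^ q 1≤k))
        (sym (distribʳ (log (fromℕ k)) 1# (fromℕ q)))))

  -- If the natural numbers were bounded, they would have a supremum `s`; as n + 1 ≤ s for every n,
  -- `s - 1#` would be a smaller upper bound.
  archimedean : ExcludedMiddle 0ℓ → ∀ x → ∃[ n ] x ≤ fromℕ n
  archimedean em x with em {∃[ n ] x ≤ fromℕ n}
  ... | yes bounded   = bounded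
  ... | no  unbounded = contradiction (+-cancelʳ-≤ s (begin
      1# + s   ≤⟨ +-monoʳ-≤ 1# (least (s - 1#) below) ⟩
      1# + (s - 1#)  ≡⟨ trans (+-comm 1# (s - 1#)) (x-y+y s 1#) ⟩
      s        ≡⟨ +-identityˡ s ⟨
      0# + s   ∎)) (<⇒≱ 0<1)
    where
    Natural : ℝ → Set
    Natural y = ∃[ n ] y ≡ fromℕ n
    supremum = complete Natural (0# , 0 , refl)
      (x , λ { _ (n , refl) → proj₁ (≰⇒> λ x≤n → unbounded (n , x≤n)) })
    s = proj₁ supremum
    least = proj₂ (proj₂ supremum)
    below : UpperBound Natural (s - 1#)
    below _ (n , refl) = x+z≤y⇒z≤y-x (proj₁ (proj₂ supremum) (fromℕ (suc n)) (suc n , refl))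

  -- By `exp-≥` the power is at least `α * log x`, and this reaches `B` at exp (B / α).
  ^-large : ∀ {α} → 0# < α → ∀ B → ∃[ b ] ∀ {x} → b ≤ x → B ≤ x ^ α
  ^-large {α} 0<α B = exp (B / α) , λ {x} b≤x → begin
    B                ≡⟨ trans (*-comm α (B / α)) (x*y⁻¹*y B (>⇒≢0 0<α)) ⟨
    α * (B / α)      ≤⟨ *-monoʳ-≤ (proj₁ 0<α) (exp≤⇒≤log b≤x) ⟩
    α * log x        ≡⟨ +-identityˡ _ ⟨
    0# + α * log x   ≤⟨ +-monoˡ-≤ (α * log x) 0≤1 ⟩
    1# + α * log x   ≤⟨ exp-≥ (α * log x) ⟩
    x ^ α            ∎

  -- Constants as sub-polynomial functions

  open Streaming R

  -- Constants serve twice: as the test function that refutes near periodicity, and as the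
  -- reciprocal accuracy against which tractability is tested.
  const-subPolynomial : ∀ {X : Set} (ι : X → ℝ) {c} → 0# < c → SubPolynomialOn ι (λ _ → c)
  const-subPolynomial ι {c} 0<c =
    (λ _ _ → proj₁ 0<c) , λ α 0<α →
      (λ B → let b , large = ^-large 0<α (B / c) in b , λ x b≤x →
        subst (_≤ ι x ^ α * c) (x*y⁻¹*y B (>⇒≢0 0<c)) (*-monoˡ-≤ (proj₁ 0<c) (large b≤x))) ,
      -- The summand `1#` makes the resulting inequality strict.
      (λ η 0<η → let b , large = ^-large 0<α ((1# + c) / η) in b , λ x b≤x →
        subst (_< η) (sym (0≤x⇒∣x∣≡x (*-nonNeg (proj₁ (^-pos (ι x) (- α))) (proj₁ 0<c))))
          (small (ι x) α 0<η (large b≤x)))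
    where
    small : ∀ x α {η} → 0# < η → (1# + c) / η ≤ x ^ α → x ^ (- α) * c < η
    small x α {η} 0<η le = ≰⇒> λ η≤ → <⇒≱
      (begin-strict
        c         ≡⟨ +-identityˡ c ⟨
        0# + c    <⟨ ≰⇒> (<⇒≱ 0<1 ∘ +-cancelʳ-≤ c) ⟩
        1# + c    ≡⟨ x*y⁻¹*y (1# + c) (>⇒≢0 0<η) ⟨
        (1# + c) / η * η  ≤⟨ *-monoˡ-≤ (proj₁ 0<η) le ⟩
        x ^ α * η  ∎)
      (begin
        x ^ α * η               ≤⟨ *-monoʳ-≤ (proj₁ (^-pos x α)) η≤ ⟩
        x ^ α * (x ^ (- α) * c) ≡⟨ *-assoc _ _ _ ⟨
        x ^ α * x ^ (- α) * c   ≡⟨ cong (_* c) (trans (cong (λ z → x ^ α * exp z) (sym (-‿distribˡ-* α (log x)))) (exp-inverse (α * log x))) ⟩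
        1# * c                  ≡⟨ *-identityˡ c ⟩
        c                       ∎)

-- Streams encoding the INDEX problem

∈⇒length≢0 : ∀ {X : Set} {x : X} {xs} → x ∈ xs → NonZero (length xs)
∈⇒length≢0 (here _)  = _
∈⇒length≢0 (there _) = _

replicate∈tuples : ∀ c k → Vec.replicate k zero ∈ tuples (suc c) k
replicate∈tuples c zero    = here refl
replicate∈tuples c (suc k) = ∈-cartesianProductWith⁺ _∷_ (∈-allFin zero) (replicate∈tuples c k)

length-tuples≢0 : ∀ c {{_ : NonZero c}} k → NonZero (length (tuples c k))
length-tuples≢0 (suc c) k = ∈⇒length≢0 (replicate∈tuples c k)

-- All updates are non-negative here, so frequencies only grow along the stream and a bound at its
-- end holds for every prefix.
ℕStream : ℕ → Set
ℕStream n = List (Fin n × ℕ)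

embed : ∀ {n} → ℕStream n → Stream n
embed = map (λ (i , d) → i , ℤ.+ d)

at : ∀ {n} → Fin n → Fin n × ℕ → ℕ
at i (j , d) = if does (j Fin.≟ i) then d else 0

ℕfrequency : ∀ {n} → ℕStream n → Fin n → ℕ
ℕfrequency E i = ∑ E (at i)

frequency-embed : ∀ {n} (E : ℕStream n) i → frequency (embed E) i ≡ ℤ.+ ℕfrequency E i
frequency-embed []            i = refl
frequency-embed ((j , d) ∷ E) i with j Fin.≟ i
... | yes _ = cong (ℤ._+_ (ℤ.+ d)) (frequency-embed E i)
... | no  _ = frequency-embed E i

∑-take : ∀ {X : Set} k (xs : List X) f → ∑ (take k xs) f ℕ.≤ ∑ xs f
∑-take zero    xs       f = z≤n
∑-take (suc k) []       f = z≤n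
∑-take (suc k) (x ∷ xs) f = ℕ.+-monoʳ-≤ (f x) (∑-take k xs f)

embed-𝒟 : ∀ {n M} (E : ℕStream n) → (∀ i → ℕfrequency E i ℕ.≤ M) → 𝒟 n (length E) M (embed E)
embed-𝒟 {n} {M} E bounded = ℕ.≤-reflexive (length-map _ E) , λ k i →
  subst (λ v → ℤ.∣ v ∣ ℕ.≤ M)
    (sym (trans (cong (λ D → frequency D i) (take-map k E)) (frequency-embed (take k E) i)))
    (ℕ.≤-trans (∑-take k E (at i)) (bounded i))

∑-allFin-at : ∀ {n} (d : Fin n → ℕ) i → ∑ (allFin n) (λ j → at i (j , d j)) ≡ d i
∑-allFin-at {suc n} d zero = trans (∑-allFin-suc (λ j → at zero (j , d j)))
  (trans (cong (d zero ℕ.+_) (trans (∑-const (allFin n) 0) (ℕ.*-zeroʳ (length (allFin n))))) (ℕ.+-identityʳ (d zero)))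
∑-allFin-at {suc n} d (suc i) = trans (∑-allFin-suc (λ j → at (suc i) (j , d j)))
  (∑-allFin-at (d ∘ suc) i)

-- Alice sends frequency y at the indices in her set A and 0 elsewhere (so that
-- the length does not depend on A); Bob adds x at his index b.
alice : ∀ {n} → ℕ → Vec Bool n → ℕStream n
alice y A = map (λ i → i , (if lookup A i then y else 0)) (allFin _)

bob : ∀ {n} → ℕ → Fin n → ℕStream n
bob x b = (b , x) ∷ []

indexStream : ∀ {n} → ℕ → ℕ → Vec Bool n → Fin n → ℕStream n
indexStream x y A b = alice y A ++ bob x b

ℕfrequency-indexStream : ∀ {n} x y (A : Vec Bool n) b i →
  ℕfrequency (indexStream x y A b) i ≡ (if lookup A i then y else 0) ℕ.+ at i (b , x)
ℕfrequency-indexStream {n} x y A b i = trans (∑-++ (alice y A) (bob x b) (at i))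
  (cong₂ ℕ._+_
    (trans (∑-map (allFin n) _ (at i)) (∑-allFin-at (λ j → if lookup A j then y else 0) i))
    (ℕ.+-identityʳ _))

at-self : ∀ {n} (i : Fin n) d → at i (i , d) ≡ d
at-self i d with i Fin.≟ i
... | yes _   = refl
... | no  i≢i = contradiction refl i≢i

at-other : ∀ {n} {i j : Fin n} d → j ≢ i → at i (j , d) ≡ 0
at-other {i = i} {j} d j≢i with j Fin.≟ i
... | yes j≡i = contradiction j≡i j≢i
... | no  _   = refl

at≤ : ∀ {n} (i j : Fin n) d → at i (j , d) ℕ.≤ d
at≤ i j d with j Fin.≟ i
... | yes _ = ℕ.≤-refl
... | no  _ = z≤n

indexStream-bounded : ∀ {n} x y (A : Vec Bool n) b i →
  ℕfrequency (indexStream x y A b) i ℕ.≤ x ℕ.+ y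
indexStream-bounded x y A b i = begin
  ℕfrequency (indexStream x y A b) i                ≡⟨ ℕfrequency-indexStream x y A b i ⟩
  (if lookup A i then y else 0) ℕ.+ at i (b , x)    ≤⟨ ℕ.+-mono-≤ (if≤ (lookup A i)) (at≤ i b x) ⟩
  y ℕ.+ x                                           ≡⟨ ℕ.+-comm y x ⟩
  x ℕ.+ y                                           ∎
  where
  open ℕ.≤-Reasoning
  if≤ : ∀ a → (if a then y else 0) ℕ.≤ y
  if≤ true  = ℕ.≤-refl
  if≤ false = z≤n

length-indexStream : ∀ {n} x y (A : Vec Bool n) b → length (indexStream x y A b) ≡ n ℕ.+ 1
length-indexStream {n} x y A b = trans (length-++ (alice y A))
  (cong (ℕ._+ 1) (trans (length-map _ (allFin n)) (length-tabulate {n = n} id)))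

-- From a one-pass algorithm to an INDEX protocol

module IndexReduction (R : Reals) where
  open Reals R using (ℝ; 1#; _+_; _-_; _*_; _≤_)
  open Streaming R

  module _ {p n} (Alg : Algorithm p n) where
    open Algorithm Alg

    -- `process` with the draws in a list, so that a run can be cut between Alice and Bob without
    -- length equations in types. Stopping when the draws run out is a default under which `run-++`
    -- holds for all lists.
    run : List (Fin p × Update n) → List (Fin draws) → Memory → Memory
    run []             _       σ = σ
    run (_ ∷ _)        []      σ = σ
    run ((j , u) ∷ us) (r ∷ rs) σ = run us rs (step j r u σ)

    process≡run : ∀ us ρ σ → process us ρ σ ≡ run us (Vec.toList ρ) σ
    process≡run []             []      σ = refl
    process≡run ((j , u) ∷ us) (r ∷ ρ) σ = process≡run us ρ (step j r u σ)

    run-++ : ∀ us vs rs σ → run (us ++ vs) rs σ ≡ run vs (drop (length us) rs) (run us rs σ)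
    run-++ []             vs rs       σ = refl
    run-++ (_ ∷ _)        []       [] σ = refl
    run-++ (_ ∷ _)        (_ ∷ _)  [] σ = refl
    run-++ ((j , u) ∷ us) vs (r ∷ rs) σ = run-++ us vs rs (step j r u σ)

  -- The type of the random draws depends on the stream through its length; the
  -- two indexings of the same draws are compared as lists.
  count-transport : ∀ {c L L′} → L ≡ L′ →
    ∀ {P : Pred (Vec (Fin c) (2 ℕ.+ L)) _} (P? : Decidable P) (f : Vec (Fin c) (2 ℕ.+ L′) → ℕ) →
    (∀ r₀ r₁ ρ ρ′ → Vec.toList ρ ≡ Vec.toList ρ′ → P (r₀ ∷ r₁ ∷ ρ) → f (r₀ ∷ r₁ ∷ ρ′) ≡ 1) →
    2 ℕ.* length (tuples c (2 ℕ.+ L)) ℕ.≤ 3 ℕ.* length (filter P? (tuples c (2 ℕ.+ L))) →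
    2 ℕ.* length (tuples c (2 ℕ.+ L′)) ℕ.≤ 3 ℕ.* ∑ (tuples c (2 ℕ.+ L′)) f
  count-transport {c} {L} refl P? f P⇒1 likely = ℕ.≤-trans likely
    (ℕ.*-monoʳ-≤ 3 (length-filter≤∑ P? f (λ { {r₀ ∷ r₁ ∷ ρ} → P⇒1 r₀ r₁ ρ ρ refl }) (tuples c (2 ℕ.+ L))))

  -- If every accurate estimate reveals the bit, the memory between Alice's and Bob's updates is the
  -- message of an INDEX protocol on 15k bits. All draws are treated as public coins.
  space-lower-bound : ∀ k (Alg : Algorithm 1 (3 ℕ.* (5 ℕ.* k))) g ε x y (guess : ℝ → Bool) →
    (∀ A b G → let S = g-sum g (frequency (embed (indexStream x y A b))) in
      (1# - ε) * S ≤ G → G ≤ (1# + ε) * S → guess G ≡ lookup A b) →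
    (∀ A b → SolvesSum g ε Alg (embed (indexStream x y A b))) →
    k ℕ.≤ Algorithm.space Alg
  space-lower-bound k Alg g ε x y guess separates solves =
    index-space-bound k space
      (Index.2^[2m]*2^n≤2^s*3^n Rs {{length-tuples≢0 draws (2 ℕ.+ L)}} (5 ℕ.* k) space
        encode decode correct)
    where
    open Algorithm Alg
    n = 3 ℕ.* (5 ℕ.* k)
    L = n ℕ.+ 1
    Rs = tuples draws (2 ℕ.+ L)
    stream : Vec Bool n → Fin n → Stream n
    stream A b = embed (indexStream x y A b)
    tag : ℕStream n → List (Fin 1 × Update n)
    tag E = map (zero ,_) (embed E)
    length-tag : ∀ E → length (tag E) ≡ length E
    length-tag E = trans (length-map _ (embed E)) (length-map _ E)
    encode : Vec (Fin draws) (2 ℕ.+ L) → Vec Bool n → Memory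
    encode (r₀ ∷ _ ∷ ρ) A = run Alg (tag (alice y A)) (Vec.toList ρ) (start r₀)
    -- Alice's updates consume the first `n` draws, one for each index; Bob continues with the last
    -- one.
    decode : Vec (Fin draws) (2 ℕ.+ L) → Memory → Fin n → Bool
    decode (_ ∷ r₁ ∷ ρ) σ b = guess (output r₁ (run Alg (tag (bob x b)) (drop n (Vec.toList ρ)) σ))
    passes≡ : ∀ A b → passes 1 (stream A b) ≡ tag (alice y A) ++ tag (bob x b)
    passes≡ A b = trans (++-identityʳ (tag (indexStream x y A b)))
      (trans (cong (map (zero ,_)) (map-++ _ (alice y A) (bob x b))) (map-++ _ (embed (alice y A)) (embed (bob x b))))
    length-alice : ∀ A → length (tag (alice y A)) ≡ n
    length-alice A = trans (length-tag (alice y A)) (trans (length-map _ (allFin n)) (length-tabulate {n = n} id))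
    result≡ : ∀ A b r₀ r₁ ρ ρ′ → Vec.toList ρ ≡ Vec.toList ρ′ →
      decode (r₀ ∷ r₁ ∷ ρ′) (encode (r₀ ∷ r₁ ∷ ρ′) A) b ≡ guess (result (stream A b) (r₀ ∷ r₁ ∷ ρ))
    result≡ A b r₀ r₁ ρ ρ′ ρ≡ρ′ = cong (guess ∘ output r₁) (sym (begin
      process (passes 1 (stream A b)) ρ σ₀
        ≡⟨ process≡run Alg (passes 1 (stream A b)) ρ σ₀ ⟩
      run Alg (passes 1 (stream A b)) (Vec.toList ρ) σ₀
        ≡⟨ cong₂ (λ us rs → run Alg us rs σ₀) (passes≡ A b) ρ≡ρ′ ⟩
      run Alg (tag (alice y A) ++ tag (bob x b)) (Vec.toList ρ′) σ₀
        ≡⟨ run-++ Alg (tag (alice y A)) (tag (bob x b)) (Vec.toList ρ′) σ₀ ⟩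
      run Alg (tag (bob x b)) (drop (length (tag (alice y A))) (Vec.toList ρ′)) (encode (r₀ ∷ r₁ ∷ ρ′) A)
        ≡⟨ cong (λ l → run Alg (tag (bob x b)) (drop l (Vec.toList ρ′)) (encode (r₀ ∷ r₁ ∷ ρ′) A)) (length-alice A) ⟩
      run Alg (tag (bob x b)) (drop n (Vec.toList ρ′)) (encode (r₀ ∷ r₁ ∷ ρ′) A) ∎))
      where
      open ≡-Reasoning
      σ₀ : Memory
      σ₀ = start r₀
    length-passes : ∀ A b → length (passes 1 (stream A b)) ≡ L
    length-passes A b = trans (cong length (++-identityʳ (tag (indexStream x y A b))))
      (trans (length-tag (indexStream x y A b)) (length-indexStream x y A b))
    correct : ∀ A b → 2 ℕ.* length Rs ℕ.≤
      3 ℕ.* ∑ Rs (λ ρ → matches (decode ρ (encode ρ A) b) (lookup A b))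
    correct A b = count-transport (length-passes A b) (accurate? g ε Alg (stream A b)) _
      (λ r₀ r₁ ρ ρ′ ρ≡ρ′ (lower , upper) → matches-≡
        (trans (result≡ A b r₀ r₁ ρ ρ′ ρ≡ρ′) (separates A b _ lower upper)))
      (solves A b)

-- Bounds for the sums of the INDEX streams

module Bounds (R : Reals) where
  open Reals R
  open RealProperties R
  open ≤-Reasoning

  term≤sum : ∀ {n} (f : Fin n → ℝ) → (∀ i → 0# ≤ f i) → ∀ b → f b ≤ sum f
  term≤sum {suc n} f f≥0 zero = begin
    f zero                     ≡⟨ +-identityʳ (f zero) ⟨
    f zero + 0#                ≤⟨ +-monoʳ-≤ (f zero) (sum-nonNeg (f ∘ suc) (f≥0 ∘ suc)) ⟩
    f zero + sum (f ∘ suc)     ∎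
    where
    sum-nonNeg : ∀ {n} (f : Fin n → ℝ) → (∀ i → 0# ≤ f i) → 0# ≤ sum f
    sum-nonNeg {zero}  f f≥0 = ≤-refl
    sum-nonNeg {suc n} f f≥0 = +-nonNeg (f≥0 zero) (sum-nonNeg (f ∘ suc) (f≥0 ∘ suc))
  term≤sum {suc n} f f≥0 (suc b) = begin
    f (suc b)                  ≡⟨ +-identityˡ (f (suc b)) ⟨
    0# + f (suc b)             ≤⟨ +-mono-≤ (f≥0 zero) (term≤sum (f ∘ suc) (f≥0 ∘ suc) b) ⟩
    f zero + sum (f ∘ suc)     ∎

  sum≤n*t : ∀ {n} (f : Fin n → ℝ) {t} → (∀ i → f i ≤ t) → sum f ≤ fromℕ n * t
  sum≤n*t {zero}  f {t} f≤t = ≤-reflexive (sym (zeroˡ t))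
  sum≤n*t {suc n} f {t} f≤t = begin
    f zero + sum (f ∘ suc)     ≤⟨ +-mono-≤ (f≤t zero) (sum≤n*t (f ∘ suc) (f≤t ∘ suc)) ⟩
    t + fromℕ n * t            ≡⟨ cong (_+ fromℕ n * t) (*-identityˡ t) ⟨
    1# * t + fromℕ n * t       ≡⟨ distribʳ t 1# (fromℕ n) ⟨
    fromℕ (suc n) * t          ∎

  -- Counting one `t` for the index `b` as well keeps the factor `n` instead of n - 1.
  sum≤n*t+term : ∀ {n} (f : Fin n → ℝ) {t} → 0# ≤ t → ∀ b → (∀ i → b ≢ i → f i ≤ t) →
    sum f ≤ fromℕ n * t + f b
  sum≤n*t+term {suc n} f {t} 0≤t zero f≤t = begin
    f zero + sum (f ∘ suc)        ≤⟨ +-monoʳ-≤ (f zero) (sum≤n*t (f ∘ suc) (λ i → f≤t (suc i) λ ())) ⟩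
    f zero + fromℕ n * t          ≡⟨ +-comm (f zero) _ ⟩
    fromℕ n * t + f zero          ≤⟨ +-monoˡ-≤ (f zero) (*-monoˡ-≤ 0≤t (fromℕ-mono-≤ (ℕ.n≤1+n n))) ⟩
    fromℕ (suc n) * t + f zero    ∎
  sum≤n*t+term {suc n} f {t} 0≤t (suc b) f≤t = begin
    f zero + sum (f ∘ suc)              ≤⟨ +-mono-≤ (f≤t zero λ ()) (sum≤n*t+term (f ∘ suc) 0≤t b
                                             (λ i b≢i → f≤t (suc i) (λ { refl → b≢i refl }))) ⟩
    t + (fromℕ n * t + f (suc b))       ≡⟨ +-assoc t _ _ ⟨
    t + fromℕ n * t + f (suc b)         ≡⟨ cong (λ z → z + fromℕ n * t + f (suc b)) (*-identityˡ t) ⟨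
    1# * t + fromℕ n * t + f (suc b)    ≡⟨ cong (_+ f (suc b)) (distribʳ t 1# (fromℕ n)) ⟨
    fromℕ (suc n) * t + f (suc b)       ∎

  open Streaming R using (g-sum)

  module _ {h : ℕ → ℝ} (h0≡0 : h 0 ≡ 0#) (h≥0 : ∀ z → 0# ≤ h z)
           {n} (x y : ℕ) (A : Vec Bool n) (b : Fin n) where
    private
      S : ℝ
      S = g-sum h (frequency (embed (indexStream x y A b)))
      f : Fin n → ℝ
      f i = h ℤ.∣ frequency (embed (indexStream x y A b)) i ∣
      f≡ : ∀ i → f i ≡ h ((if lookup A i then y else 0) ℕ.+ at i (b , x))
      f≡ i = cong h (trans (cong ℤ.∣_∣ (frequency-embed (indexStream x y A b) i))
        (ℕfrequency-indexStream x y A b i))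
      value : ℝ
      value = h ((if lookup A b then y else 0) ℕ.+ x)
      f-b : f b ≡ value
      f-b = trans (f≡ b) (cong (λ d → h ((if lookup A b then y else 0) ℕ.+ d)) (at-self b x))
      f-other : ∀ i → b ≢ i → f i ≤ h y
      f-other i b≢i = subst (_≤ h y) (sym (trans (f≡ i)
        (cong h (trans (cong ((if lookup A i then y else 0) ℕ.+_) (at-other x b≢i)) (ℕ.+-identityʳ _)))))
        (bit (lookup A i))
        where
        bit : ∀ a → h (if a then y else 0) ≤ h y
        bit true  = ≤-refl
        bit false = subst (_≤ h y) (sym h0≡0) (h≥0 y)

    sum-lower : h ((if lookup A b then y else 0) ℕ.+ x) ≤ S
    sum-lower = subst (_≤ S) f-b (term≤sum f (λ i → h≥0 _) b)

    -- Outside Bob's index the frequencies are 0 or y, and h 0 = 0, so these terms are noise of at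
    -- most `h y` each.
    sum-upper : S ≤ fromℕ n * h y + h ((if lookup A b then y else 0) ℕ.+ x)
    sum-upper = subst (λ v → S ≤ fromℕ n * h y + v) f-b (sum≤n*t+term f (h≥0 y) b f-other)

-- The accuracy and the decoding threshold

module Accuracy (R : Reals) {u : Reals.ℝ R} (0<u : Reals._<_ R (Reals.0# R) u) where
  open Reals R
  open RealProperties R
  open ≤-Reasoning
  open Streaming R using (g-sum)

  -- With this `ε` an underestimate loses at most the factor exp (- u), by equality, and an
  -- overestimate gains at most exp u. The gap factor r = exp (4u) outweighs these errors.
  ε r : ℝ
  ε = 1# - exp (- u)
  r = exp (u + u + u + u)

  1-ε≡exp[-u] : 1# - ε ≡ exp (- u)
  1-ε≡exp[-u] = trans (cong (1# +_) (trans (sym (-‿+-comm 1# (- exp (- u)))) (cong (- 1# +_) (-‿involutive _))))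
    (trans (sym (+-assoc 1# (- 1#) _)) (trans (cong (_+ exp (- u)) (-‿inverseʳ 1#)) (+-identityˡ _)))

  -- The sum of the tangent inequalities at `u` and `- u`: 2 ≤ exp u + exp (- u).
  1+ε≤exp[u] : 1# + ε ≤ exp u
  1+ε≤exp[u] = +-cancelʳ-≤ (exp (- u)) (begin
    1# + (1# - exp (- u)) + exp (- u)   ≡⟨ trans (+-assoc 1# _ _) (cong (1# +_) (x-y+y 1# (exp (- u)))) ⟩
    1# + 1#                             ≡⟨ x+y-y (1# + 1#) u ⟨
    1# + 1# + u + - u                   ≡⟨ cong (_- u) (trans (+-assoc 1# 1# u) (+-comm 1# (1# + u))) ⟩
    1# + u + 1# + - u                   ≡⟨ +-assoc (1# + u) 1# (- u) ⟩
    (1# + u) + (1# - u)                 ≤⟨ +-mono-≤ (exp-≥ u) (exp-≥ (- u)) ⟩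
    exp u + exp (- u)                   ∎)

  exp[-u]<1 : exp (- u) < 1#
  exp[-u]<1 = ≰⇒> λ 1≤ → <⇒≱ 0<u (exp-cancel-≤ (begin
    exp u                ≡⟨ *-identityʳ (exp u) ⟨
    exp u * 1#           ≤⟨ *-monoʳ-≤ (proj₁ (exp-pos u)) 1≤ ⟩
    exp u * exp (- u)    ≡⟨ exp-inverse u ⟩
    1#                   ≡⟨ exp-0 ⟨
    exp 0#               ∎))

  0<ε : 0# < ε
  0<ε = ≰⇒> λ ε≤0 → <⇒≱ exp[-u]<1 (begin
    1#              ≡⟨ x-y+y 1# (exp (- u)) ⟨
    ε + exp (- u)   ≤⟨ +-monoˡ-≤ (exp (- u)) ε≤0 ⟩
    0# + exp (- u)  ≡⟨ +-identityˡ _ ⟩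
    exp (- u)       ∎)

  1<r : 1# < r
  1<r = ≰⇒> λ r≤1 → <⇒≱ 0<u (begin
    u              ≡⟨ +-identityˡ u ⟨
    0# + u         ≤⟨ +-monoˡ-≤ u (+-nonNeg (+-nonNeg 0≤u 0≤u) 0≤u) ⟩
    u + u + u + u  ≤⟨ exp-cancel-≤ (≤-trans r≤1 (≤-reflexive (sym exp-0))) ⟩
    0#             ∎)
    where
    0≤u = proj₁ 0<u

  1≤r : 1# ≤ r
  1≤r = proj₁ 1<r

  0<r : 0# < r
  0<r = exp-pos _

  -- In exponents this is 2u < 3u. It is the margin between the two cases of INDEX: on the left one
  -- factor for the noise and one for overestimation, on the right the gap reduced by
  -- underestimation.
  exp[u]²<r*exp[-u] : exp u * exp u < r * exp (- u)
  exp[u]²<r*exp[-u] = ≰⇒> λ le → <⇒≱ 0<u (+-cancelʳ-≤ (u + u + u) (begin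
    u + (u + u + u)   ≡⟨ +-comm u _ ⟩
    u + u + u + u     ≤⟨ exp-cancel-≤ (begin
      r                            ≡⟨ trans (cong (r *_) (trans (*-comm _ _) (exp-inverse u))) (*-identityʳ r) ⟨
      r * (exp (- u) * exp u)      ≡⟨ *-assoc r _ _ ⟨
      r * exp (- u) * exp u        ≤⟨ *-monoˡ-≤ (proj₁ (exp-pos u)) le ⟩
      exp u * exp u * exp u        ≡⟨ trans (exp-+ (u + u) u) (cong (_* exp u) (exp-+ u u)) ⟨
      exp (u + u + u)              ∎) ⟩
    u + u + u         ≡⟨ +-identityˡ _ ⟨
    0# + (u + u + u)  ∎))

  module _ {H : ℝ} (0<H : 0# < H) {S G : ℝ} where

    above-threshold : H ≤ S → (1# - ε) * S ≤ G → does ((1# - ε) * H ≤? G) ≡ true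
    above-threshold H≤S lower = dec-true (_ ≤? _) (≤-trans
      (*-monoʳ-≤ (subst (0# ≤_) (sym 1-ε≡exp[-u]) (proj₁ (exp-pos (- u)))) H≤S) lower)

    -- An estimate at the threshold would give r (1 - ε) H ≤ r G ≤ (1 + ε) r S ≤ (1 + ε)² H,
    -- contrary to the margin `exp[u]²<r*exp[-u]`.
    below-threshold : r * S ≤ (1# + ε) * H → G ≤ (1# + ε) * S → does ((1# - ε) * H ≤? G) ≡ false
    below-threshold rS≤ upper = dec-false (_ ≤? _) λ le → <⇒≱ (*-monoˡ-< 0<H exp[u]²<r*exp[-u]) (begin
      r * exp (- u) * H           ≡⟨ trans (cong (λ z → r * z * H) (sym 1-ε≡exp[-u])) (*-assoc r _ H) ⟩
      r * ((1# - ε) * H)          ≤⟨ *-monoʳ-≤ (proj₁ 0<r) (≤-trans le upper) ⟩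
      r * ((1# + ε) * S)          ≡⟨ solve 3 (λ a b c → a :* (b :* c) := b :* (a :* c)) refl r (1# + ε) S ⟩
      (1# + ε) * (r * S)          ≤⟨ *-monoʳ-≤ 0≤1+ε rS≤ ⟩
      (1# + ε) * ((1# + ε) * H)   ≡⟨ *-assoc _ _ H ⟨
      (1# + ε) * (1# + ε) * H     ≤⟨ *-monoˡ-≤ (proj₁ 0<H) (*-mono-≤ (proj₁ (exp-pos u)) 0≤1+ε 1+ε≤exp[u] 1+ε≤exp[u]) ⟩
      exp u * exp u * H           ∎)
      where
      0≤1+ε : 0# ≤ 1# + ε
      0≤1+ε = +-nonNeg 0≤1 (proj₁ 0<ε)

  module _ {h : ℕ → ℝ} (h0≡0 : h 0 ≡ 0#) (h≥0 : ∀ z → 0# ≤ h z) (n : ℕ) {x y : ℕ}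
           (0<hx : 0# < h x) (small : r * (fromℕ n * h y) ≤ ε * h x) where
    open Bounds R

    Separates : (ℝ → Bool) → Set
    Separates guess = ∀ (A : Vec Bool n) b G → let S = g-sum h (frequency (embed (indexStream x y A b))) in
      (1# - ε) * S ≤ G → G ≤ (1# + ε) * S → guess G ≡ lookup A b

    -- The threshold is 1 - ε times a lower bound for the larger of the two possible terms at `b`:
    -- `r * h x` if the gap goes up, `h x` if it goes down. In the second case the larger term means
    -- that b is not in A, hence the negation.
    threshold : r * h x ≤ h (x ℕ.+ y) ⊎ r * h (x ℕ.+ y) ≤ h x → ∃[ guess ] Separates guess
    threshold (inj₁ up) = (λ G → does ((1# - ε) * (r * h x) ≤? G)) , λ A b G lower upper →
      case A b G lower upper (lookup A b) (sum-lower h0≡0 h≥0 x y A b) (sum-upper h0≡0 h≥0 x y A b)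
      where
      case : ∀ A b G → let S = g-sum h (frequency (embed (indexStream x y A b))) in
        (1# - ε) * S ≤ G → G ≤ (1# + ε) * S → ∀ a →
        h ((if a then y else 0) ℕ.+ x) ≤ S → S ≤ fromℕ n * h y + h ((if a then y else 0) ℕ.+ x) →
        does ((1# - ε) * (r * h x) ≤? G) ≡ a
      case A b G lower upper true  S≥ S≤ = above-threshold (*-pos 0<r 0<hx)
        (≤-trans (subst (λ z → r * h x ≤ h z) (ℕ.+-comm x y) up) S≥) lower
      case A b G lower upper false S≥ S≤ = below-threshold (*-pos 0<r 0<hx) (begin
        r * S                               ≤⟨ *-monoʳ-≤ (proj₁ 0<r) S≤ ⟩
        r * (fromℕ n * h y + h x)           ≡⟨ distribˡ r _ _ ⟩
        r * (fromℕ n * h y) + r * h x       ≤⟨ +-monoˡ-≤ (r * h x) small ⟩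
        ε * h x + r * h x                   ≤⟨ +-monoˡ-≤ (r * h x) (*-monoʳ-≤ (proj₁ 0<ε) hx≤rhx) ⟩
        ε * (r * h x) + r * h x             ≡⟨ cong (ε * (r * h x) +_) (*-identityˡ _) ⟨
        ε * (r * h x) + 1# * (r * h x)      ≡⟨ trans (sym (distribʳ _ ε 1#)) (cong (_* (r * h x)) (+-comm ε 1#)) ⟩
        (1# + ε) * (r * h x)                ∎) upper
        where
        S = g-sum h (frequency (embed (indexStream x y A b)))
        hx≤rhx : h x ≤ r * h x
        hx≤rhx = subst (_≤ r * h x) (*-identityˡ (h x)) (*-monoˡ-≤ (proj₁ 0<hx) 1≤r)
    threshold (inj₂ down) = (λ G → not (does ((1# - ε) * h x ≤? G))) , λ A b G lower upper →
      case A b G lower upper (lookup A b) (sum-lower h0≡0 h≥0 x y A b) (sum-upper h0≡0 h≥0 x y A b)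
      where
      case : ∀ A b G → let S = g-sum h (frequency (embed (indexStream x y A b))) in
        (1# - ε) * S ≤ G → G ≤ (1# + ε) * S → ∀ a →
        h ((if a then y else 0) ℕ.+ x) ≤ S → S ≤ fromℕ n * h y + h ((if a then y else 0) ℕ.+ x) →
        not (does ((1# - ε) * h x ≤? G)) ≡ a
      case A b G lower upper false S≥ S≤ = cong not (above-threshold 0<hx S≥ lower)
      case A b G lower upper true  S≥ S≤ = cong not (below-threshold 0<hx (begin
        r * S                                   ≤⟨ *-monoʳ-≤ (proj₁ 0<r) S≤ ⟩
        r * (fromℕ n * h y + h (y ℕ.+ x))       ≡⟨ distribˡ r _ _ ⟩
        r * (fromℕ n * h y) + r * h (y ℕ.+ x)   ≤⟨ +-mono-≤ small (subst (λ z → r * h z ≤ h x) (ℕ.+-comm x y) down) ⟩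
        ε * h x + h x                           ≡⟨ cong (ε * h x +_) (*-identityˡ _) ⟨
        ε * h x + 1# * h x                      ≡⟨ trans (sym (distribʳ _ ε 1#)) (cong (_* h x) (+-comm ε 1#)) ⟩
        (1# + ε) * h x                          ∎) upper)
        where
        S = g-sum h (frequency (embed (indexStream x y A b)))

-- The perturbed function

module Gaps (R : Reals) (r : Reals.ℝ R) where
  open Reals R
  Gap : ℝ → ℝ → Set
  Gap a b = r * a ≤ b ⊎ r * b ≤ a

  -- Both normality and intractability are derived from such pairs with arbitrarily large `y`.
  GapPeriod : (ℕ → ℝ) → ℝ → ℕ → ℕ → Set
  GapPeriod h β x y =
    x ℕ.< y × 0# < h x × 0# < h (x ℕ.+ y) × h y * fromℕ y ^ β ≤ h x × Gap (h x) (h (x ℕ.+ y))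

  GapPeriodic : (ℕ → ℝ) → ℝ → Set
  GapPeriodic h β = ∀ N → ∃[ x ] ∃[ y ] N ℕ.≤ y × GapPeriod h β x y

module Perturbation (em : ExcludedMiddle 0ℓ) (R : Reals) (r : Reals.ℝ R) (1≤r : Reals._≤_ R (Reals.1# R) r)
                    (g : ℕ → Reals.ℝ R) (α : Reals.ℝ R) where
  open Reals R
  open RealProperties R
  open Streaming R
  open Gaps R r
  open ≤-Reasoning

  0≤r : 0# ≤ r
  0≤r = ≤-trans 0≤1 1≤r

  -- The condition 2 ≤ y excludes z = 1, where the value must remain 1.
  Jump : ℕ → Set
  Jump z = ∃[ x ] ∃[ y ] z ≡ x ℕ.+ y × x ℕ.< y × 2 ℕ.≤ y × g y * fromℕ y ^ α ≤ g x

  -- A gap that is present already is kept. Otherwise r b > a, so one factor `r` lifts b above a and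
  -- the second opens the gap.
  separate : ℝ → ℝ → ℝ
  separate a b with r * a ≤? b | r * b ≤? a
  ... | no _ | no _ = r * r * b
  ... | _    | _    = b

  separate-values : ∀ a b → separate a b ≡ b ⊎ separate a b ≡ r * r * b
  separate-values a b with r * a ≤? b | r * b ≤? a
  ... | yes _ | _     = inj₁ refl
  ... | no _  | yes _ = inj₁ refl
  ... | no _  | no _  = inj₂ refl

  separate-gap : ∀ a b → Gap a (separate a b)
  separate-gap a b with r * a ≤? b | r * b ≤? a
  ... | yes ra≤b | _        = inj₁ ra≤b
  ... | no _     | yes rb≤a = inj₂ rb≤a
  ... | no _     | no rb≰a  = inj₁ (subst (r * a ≤_) (sym (*-assoc r r b))
    (*-monoʳ-≤ 0≤r (proj₁ (≰⇒> rb≰a))))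

  jump⇒< : ∀ {x y z} → z ≡ x ℕ.+ y → x ℕ.< y → x ℕ.< z
  jump⇒< {x} {y} refl x<y = ℕ.<-≤-trans x<y (ℕ.m≤n+m y x)

  -- The gap has to separate the new value from the perturbed value at `x`, not from g x; this is
  -- what makes the definition recursive. The decision is an argument so that proofs can split on
  -- it.
  step : ∀ z → Dec (Jump z) → (∀ {x} → x ℕ.< z → ℝ) → ℝ
  step z (yes (x , y , z≡x+y , x<y , _)) rec = separate (rec (jump⇒< z≡x+y x<y)) (g z)
  step z (no _)                          rec = g z

  step-ext : ∀ z d {rec rec′ : ∀ {x} → x ℕ.< z → ℝ} →
    (∀ {x} (x<z : x ℕ.< z) → rec x<z ≡ rec′ x<z) → step z d rec ≡ step z d rec′
  step-ext z (yes _) eq = cong (λ a → separate a (g z)) (eq _)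
  step-ext z (no _)  eq = refl

  perturbed : ℕ → ℝ
  perturbed = All.wfRec ℕ.<-wellFounded 0ℓ (λ _ → ℝ) (λ z → step z em)

  perturbed-unfold : ∀ z → perturbed z ≡ step z em (λ {x} _ → perturbed x)
  perturbed-unfold z = FixPoint.unfold-wfRec ℕ.<-wellFounded (λ _ → ℝ) (λ z → step z em)
    (λ z → step-ext z em)

  perturbed-values : ∀ z → perturbed z ≡ g z ⊎ perturbed z ≡ r * r * g z
  perturbed-values z = subst (λ h → h ≡ g z ⊎ h ≡ r * r * g z) (sym (perturbed-unfold z)) (values em)
    where
    values : ∀ d → let h = step z d (λ {x} _ → perturbed x) in h ≡ g z ⊎ h ≡ r * r * g z
    values (yes _) = separate-values _ _
    values (no _)  = inj₁ refl

  -- The decomposition obtained is the one that `em` selected in `step`; it may differ from the one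
  -- in the given `Jump z`.
  perturbed-gap : ∀ {z} → Jump z → ∃[ x ] ∃[ y ] z ≡ x ℕ.+ y × x ℕ.< y × g y * fromℕ y ^ α ≤ g x ×
    Gap (perturbed x) (perturbed z)
  perturbed-gap {z} jump = gap em (perturbed-unfold z)
    where
    gap : ∀ d → perturbed z ≡ step z d (λ {x} _ → perturbed x) →
      ∃[ x ] ∃[ y ] z ≡ x ℕ.+ y × x ℕ.< y × g y * fromℕ y ^ α ≤ g x × Gap (perturbed x) (perturbed z)
    gap (no ¬jump) _ = contradiction jump ¬jump
    gap (yes (x , y , z≡x+y , x<y , _ , le)) unfold = x , y , z≡x+y , x<y , le ,
      subst (Gap (perturbed x)) (sym unfold) (separate-gap _ _)

  module _ (g∈𝒢 : 𝒢 g) where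

    perturbed-0 : perturbed 0 ≡ 0#
    perturbed-0 with perturbed-values 0
    ... | inj₁ eq = trans eq (proj₁ g∈𝒢)
    ... | inj₂ eq = trans eq (trans (cong (r * r *_) (proj₁ g∈𝒢)) (zeroʳ (r * r)))

    ¬Jump-1 : ¬ Jump 1
    ¬Jump-1 (x , y , 1≡x+y , _ , 2≤y , _) = ℕ.<⇒≱ 2≤y (subst (y ℕ.≤_) (sym 1≡x+y) (ℕ.m≤n+m y x))

    perturbed-1 : perturbed 1 ≡ 1#
    perturbed-1 = trans (perturbed-unfold 1) (trans (unchanged em) (proj₁ (proj₂ g∈𝒢)))
      where
      unchanged : ∀ d → step 1 d (λ {x} _ → perturbed x) ≡ g 1
      unchanged (yes jump) = contradiction jump ¬Jump-1
      unchanged (no _)     = refl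

    g-nonNeg : ∀ z → 0# ≤ g z
    g-nonNeg zero    = ≤-reflexive (sym (proj₁ g∈𝒢))
    g-nonNeg (suc z) = proj₁ (proj₂ (proj₂ g∈𝒢) (suc z) (s≤s z≤n))

    1≤r² : 1# ≤ r * r
    1≤r² = subst (_≤ r * r) (*-identityˡ 1#) (*-mono-≤ 0≤r 0≤1 1≤r 1≤r)

    g≤r²g : ∀ z → g z ≤ r * r * g z
    g≤r²g z = subst (_≤ r * r * g z) (*-identityˡ (g z)) (*-monoˡ-≤ (g-nonNeg z) 1≤r²)

    g≤perturbed : ∀ z → g z ≤ perturbed z
    g≤perturbed z with perturbed-values z
    ... | inj₁ eq = ≤-reflexive (sym eq)
    ... | inj₂ eq = subst (g z ≤_) (sym eq) (g≤r²g z)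

    perturbed≤r²g : ∀ z → perturbed z ≤ r * r * g z
    perturbed≤r²g z with perturbed-values z
    ... | inj₁ eq = subst (_≤ r * r * g z) (sym eq) (g≤r²g z)
    ... | inj₂ eq = ≤-reflexive eq

    perturbed∈𝒢 : 𝒢 perturbed
    perturbed∈𝒢 = perturbed-0 , perturbed-1 ,
      λ z 0<z → <-≤-trans (proj₂ (proj₂ g∈𝒢) z 0<z) (g≤perturbed z)

    -- A large period of `g` gives a jump, hence a gap, though perhaps for another decomposition x +
    -- y; x < y still puts y above half of the sum. Half of the exponent α pays for the factor r² by
    -- which `perturbed y` may exceed `g y`.
    perturbed-gapPeriodic : (∀ N → 0 ℕ.< N → ∃[ y ] N ℕ.≤ y × IsPeriod α g y) →
      ∀ {β} → 0# < β → β + β ≡ α → GapPeriodic perturbed β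
    perturbed-gapPeriodic periodic {β} 0<β β+β≡α N with ^-large 0<β (r * r)
    ... | B , large with archimedean em B
    -- `N` is the bound asked for, `N₀` makes y ^ β at least r², and the 2 in `N₁` meets the
    -- condition in `Jump`. The doubling allows for y being little more than half of x′ + y′.
    ... | N₀ , B≤N₀ with periodic (suc (N₁ ℕ.+ N₁)) (s≤s z≤n)
      where
      N₁ = N ℕ.+ N₀ ℕ.+ 2
    ... | y′ , N′≤y′ , x′ , x′<y′ , le′ with perturbed-gap {x′ ℕ.+ y′} (x′ , y′ , refl , x′<y′ , 2≤y′ ,
            x≤y/z⇒x*z≤y (^-pos (fromℕ y′) α) le′)
      where
      2≤y′ : 2 ℕ.≤ y′
      2≤y′ = ℕ.≤-trans (ℕ.≤-trans (ℕ.m≤n+m 2 (N ℕ.+ N₀)) (ℕ.≤-trans (ℕ.m≤m+n _ _) (ℕ.n≤1+n _))) N′≤y′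
    ... | x , y , sum≡ , x<y , le , gap = x , y , N≤y , x<y , 0<hx ,
      proj₂ (proj₂ perturbed∈𝒢) (x ℕ.+ y) (ℕ.<-≤-trans 0<y (ℕ.m≤n+m y x)) , period ,
      subst (λ z → Gap (perturbed x) (perturbed z)) sum≡ gap
      where
      N₁ = N ℕ.+ N₀ ℕ.+ 2
      N₁<y : N₁ ℕ.< y
      N₁<y = ℕ.≰⇒> λ y≤N₁ → ℕ.<⇒≱
        (ℕ.≤-trans N′≤y′ (ℕ.≤-trans (ℕ.m≤n+m y′ x′) (ℕ.≤-reflexive sum≡)))
        (ℕ.+-mono-≤ (ℕ.≤-trans (ℕ.<⇒≤ x<y) y≤N₁) y≤N₁)
      N≤y : N ℕ.≤ y
      N≤y = ℕ.≤-trans (ℕ.≤-trans (ℕ.m≤m+n N N₀) (ℕ.m≤m+n _ 2)) (ℕ.<⇒≤ N₁<y)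
      N₀≤y : N₀ ℕ.≤ y
      N₀≤y = ℕ.≤-trans (ℕ.≤-trans (ℕ.m≤n+m N₀ N) (ℕ.m≤m+n _ 2)) (ℕ.<⇒≤ N₁<y)
      0<y : 0 ℕ.< y
      0<y = ℕ.≤-<-trans z≤n N₁<y
      period : perturbed y * fromℕ y ^ β ≤ perturbed x
      period = begin
        perturbed y * fromℕ y ^ β            ≤⟨ *-monoˡ-≤ (proj₁ (^-pos _ β)) (perturbed≤r²g y) ⟩
        r * r * g y * fromℕ y ^ β            ≤⟨ *-monoˡ-≤ (proj₁ (^-pos _ β)) (*-monoˡ-≤ (g-nonNeg y)
                                                  (large (≤-trans B≤N₀ (fromℕ-mono-≤ N₀≤y)))) ⟩
        fromℕ y ^ β * g y * fromℕ y ^ β      ≡⟨ solve 2 (λ a b → a :* b :* a := b :* (a :* a)) refl (fromℕ y ^ β) (g y) ⟩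
        g y * (fromℕ y ^ β * fromℕ y ^ β)    ≡⟨ cong (g y *_) (trans (sym (^-+ (fromℕ y) β β)) (cong (fromℕ y ^_) β+β≡α)) ⟩
        g y * fromℕ y ^ α                    ≤⟨ le ⟩
        g x                                  ≤⟨ g≤perturbed x ⟩
        perturbed x                          ∎
      0<hx : 0# < perturbed x
      0<hx = <-≤-trans (*-pos (proj₂ (proj₂ perturbed∈𝒢) y 0<y) (^-pos (fromℕ y) β)) period

    -- Each difference of logarithms is 0 or -δ, so completeness yields a supremum of at most δ.
    perturbed-Θ : ∀ {δ} → 0# ≤ δ → r * r ≡ exp δ → ∃[ θ ] (Θ[ g , perturbed ]≡ θ) × θ ≤ δ
    perturbed-Θ {δ} 0≤δ r²≡ = let θ , sup = complete (LogDistance g perturbed) (_ , 1 , s≤s z≤n , refl) (δ , δ-bound)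
      in θ , sup , proj₂ sup δ δ-bound
      where
      δ-bound : UpperBound (LogDistance g perturbed) δ
      δ-bound _ (x , 1≤x , refl) with perturbed-values x
      ... | inj₁ eq = subst (λ d → ∣ d ∣ ≤ δ)
        (trans (sym (-‿inverseʳ (log (g x)))) (cong (λ h → log (g x) - log h) (sym eq)))
        (subst (_≤ δ) (sym (0≤x⇒∣x∣≡x ≤-refl)) 0≤δ)
      ... | inj₂ eq = ⊔-lub
        (begin
          log (g x) - log (perturbed x)        ≤⟨ +-monoˡ-≤ _ (log-mono-≤ (proj₂ (proj₂ g∈𝒢) x 1≤x) (g≤perturbed x)) ⟩
          log (perturbed x) - log (perturbed x) ≡⟨ -‿inverseʳ _ ⟩
          0#                                    ≤⟨ 0≤δ ⟩
          δ                                     ∎)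
        (≤-reflexive (begin-equality
          - (log (g x) - log (perturbed x))     ≡⟨ -‿+-comm _ _ ⟨
          - log (g x) - - log (perturbed x)     ≡⟨ cong (- log (g x) +_) (-‿involutive _) ⟩
          - log (g x) + log (perturbed x)       ≡⟨ cong (λ l → - log (g x) + l) (begin-equality
            log (perturbed x)                     ≡⟨ cong log (trans eq (cong (_* g x) r²≡)) ⟩
            log (exp δ * g x)                     ≡⟨ log-* (exp-pos δ) (proj₂ (proj₂ g∈𝒢) x 1≤x) ⟩
            log (exp δ) + log (g x)               ≡⟨ cong (_+ log (g x)) (log-exp δ) ⟩
            δ + log (g x)                         ∎) ⟩
          - log (g x) + (δ + log (g x))         ≡⟨ +-comm _ _ ⟩
          δ + log (g x) + - log (g x)           ≡⟨ x+y-y δ _ ⟩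
          δ                                     ∎))

-- Gaps contradict near periodicity

module Normality (R : Reals) (r : Reals.ℝ R) (1<r : Reals._<_ R (Reals.1# R) r) where
  open Reals R
  open RealProperties R
  open Streaming R
  open Gaps R r
  open ≤-Reasoning

  -- With η = (r - 1) / 2 a gap makes b - a at least 2aη, twice what near periodicity would allow.
  gap-excess : ∀ {η a b d} → r ≡ 1# + (η + η) → 0# < η → 0# < a → r * a ≤ b → b - a ≤ d → ¬ (d ≤ a * η)
  gap-excess {η} {a} {b} {d} r≡ 0<η 0<a ra≤b b-a≤d d≤ = <⇒≱ (*-pos 0<a 0<η) (+-cancelʳ-≤ (a * η) (begin
    a * η + a * η     ≤⟨ x+z≤y⇒z≤y-x (begin
      a + (a * η + a * η)   ≡⟨ cong₂ _+_ (sym (*-identityˡ a)) (sym (trans (*-comm _ a) (distribˡ a η η))) ⟩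
      1# * a + (η + η) * a  ≡⟨ trans (cong (_* a) r≡) (distribʳ a 1# (η + η)) ⟨
      r * a                 ≤⟨ ra≤b ⟩
      b                     ∎) ⟩
    b - a             ≤⟨ ≤-trans b-a≤d d≤ ⟩
    a * η             ≡⟨ +-identityˡ _ ⟨
    0# + a * η        ∎))

  gapPeriodic⇒normal : ∀ {h β} → 0# < β → GapPeriodic h β → Normal 𝕊 h
  gapPeriodic⇒normal {h} {β} 0<β gaps (_ , close)
    with half {r - 1#} (≰⇒> λ r-1≤0 → <⇒≱ 1<r (subst₂ _≤_ (x-y+y r 1#) (+-identityˡ 1#) (+-monoˡ-≤ 1# r-1≤0)))
  ... | η , 0<η , η+η≡r-1
    -- Near periodicity is tested against the constant function `η`.
    with close β 0<β (λ _ → η) ((λ _ → ≤-refl) , const-subPolynomial fromℕ 0<η)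
  ... | N , _ , bound with gaps N
  ... | x , y , N≤y , x<y , 0<hx , 0<hx+y , le , gap = case gap
    where
    r≡ : r ≡ 1# + (η + η)
    r≡ = sym (trans (cong (1# +_) η+η≡r-1) (trans (+-comm 1# (r - 1#)) (x-y+y r 1#)))
    d : ℝ
    d = h (x ℕ.+ y) - h x
    near : ∣ d ∣ ≤ (h x ⊓ h (x ℕ.+ y)) * η
    near = bound y N≤y (x , x<y , x*z≤y⇒x≤y/z (^-pos (fromℕ y) β) le) x x<y le
    case : ¬ Gap (h x) (h (x ℕ.+ y))
    case (inj₁ up)   = gap-excess r≡ 0<η 0<hx up (x≤x⊔y d (- d))
      (≤-trans near (*-monoˡ-≤ (proj₁ 0<η) (x⊓y≤x (h x) (h (x ℕ.+ y)))))
    case (inj₂ down) = gap-excess r≡ 0<η 0<hx+y down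
      (subst (_≤ ∣ d ∣) (trans (sym (-‿+-comm _ _)) (trans (cong (- h (x ℕ.+ y) +_) (-‿involutive (h x))) (+-comm _ _)))
        (x≤y⊔x d (- d)))
      (≤-trans near (*-monoˡ-≤ (proj₁ 0<η) (x⊓y≤y (h x) (h (x ℕ.+ y)))))

-- Gaps contradict tractability

module Intractability (em : ExcludedMiddle 0ℓ) (R : Reals) {u : Reals.ℝ R} (0<u : Reals._<_ R (Reals.0# R) u) where
  open Reals R
  open RealProperties R
  open Streaming R
  open Accuracy R 0<u
  open Gaps R r
  open IndexReduction R
  open ≤-Reasoning

  -- The exponent collects 5 from 30 ≤ 2 ^ 5 ≤ k ^ 5, 1 from the factor k in n, and 2q from y < (1 +
  -- k) ^ q ≤ k ^ (2q).
  nM≤k^ : ∀ {k q x y} → 2 ℕ.≤ k → x ℕ.< y → y ℕ.< suc k ℕ.^ q →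
    3 ℕ.* (5 ℕ.* k) ℕ.* (x ℕ.+ y) ℕ.≤ k ℕ.^ (6 ℕ.+ 2 ℕ.* q)
  nM≤k^ {k} {q} {x} {y} 2≤k x<y y< = ℕR.begin
    3 ℕ.* (5 ℕ.* k) ℕ.* (x ℕ.+ y)             ℕR.≤⟨ ℕ.*-monoʳ-≤ (3 ℕ.* (5 ℕ.* k)) (ℕ.+-monoˡ-≤ y (ℕ.<⇒≤ x<y)) ⟩
    3 ℕ.* (5 ℕ.* k) ℕ.* (y ℕ.+ y)             ℕR.≡⟨ 30ky k y ⟩
    30 ℕ.* (k ℕ.* y)                          ℕR.≤⟨ ℕ.*-mono-≤ (ℕ.≤-trans (ℕ.m≤m+n 30 2) (ℕ.^-monoˡ-≤ 5 2≤k))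
                                                   (ℕ.*-monoʳ-≤ k (ℕ.<⇒≤ y<)) ⟩
    k ℕ.^ 5 ℕ.* (k ℕ.* suc k ℕ.^ q)           ℕR.≤⟨ ℕ.*-monoʳ-≤ (k ℕ.^ 5) (ℕ.*-monoʳ-≤ k (ℕ.^-monoˡ-≤ q 1+k≤k²)) ⟩
    k ℕ.^ 5 ℕ.* (k ℕ.* (k ℕ.^ 2) ℕ.^ q)       ℕR.≡⟨ cong (λ z → k ℕ.^ 5 ℕ.* (k ℕ.* z)) (ℕ.^-*-assoc k 2 q) ⟩
    k ℕ.^ 5 ℕ.* k ℕ.^ suc (2 ℕ.* q)           ℕR.≡⟨ ℕ.^-distribˡ-+-* k 5 (suc (2 ℕ.* q)) ⟨
    k ℕ.^ (5 ℕ.+ suc (2 ℕ.* q))               ℕR.≡⟨ cong (k ℕ.^_) (ℕ.+-suc 5 (2 ℕ.* q)) ⟩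
    k ℕ.^ (6 ℕ.+ 2 ℕ.* q)                     ℕR.∎
    where
    module ℕR = ℕ.≤-Reasoning
    30ky : ∀ k y → 3 ℕ.* (5 ℕ.* k) ℕ.* (y ℕ.+ y) ≡ 30 ℕ.* (k ℕ.* y)
    30ky = solve-∀
    1+k≤k² : suc k ℕ.≤ k ℕ.^ 2
    1+k≤k² = ℕR.begin
      1 ℕ.+ k          ℕR.≤⟨ ℕ.+-monoˡ-≤ k (ℕ.≤-trans (s≤s z≤n) 2≤k) ⟩
      k ℕ.+ k          ℕR.≡⟨ cong (k ℕ.+_) (sym (ℕ.+-identityʳ k)) ⟩
      2 ℕ.* k          ℕR.≤⟨ ℕ.*-monoˡ-≤ k 2≤k ⟩
      k ℕ.* k          ℕR.≡⟨ cong (k ℕ.*_) (sym (ℕ.*-identityʳ k)) ⟩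
      k ℕ.^ 2          ℕR.∎

  -- Since y ≥ k ^ q, the power y ^ β is at least k ^ (qβ). Of the two factors k gained, one pays
  -- for the `n` noise terms and one for the constants.
  k²≤y^β : ∀ {k q y β} → 1 ℕ.≤ k → 0# ≤ β → k ℕ.^ q ℕ.≤ y → 1# + 1# ≤ fromℕ q * β →
    fromℕ k * fromℕ k ≤ fromℕ y ^ β
  k²≤y^β {k@(suc _)} {q} {y} {β} 1≤k 0≤β k^q≤y 2≤qβ = begin
    fromℕ k * fromℕ k            ≡⟨ cong₂ _*_ (sym (exp-log (fromℕ-pos 1≤k))) (sym (exp-log (fromℕ-pos 1≤k))) ⟩
    exp l * exp l                ≡⟨ exp-+ l l ⟨
    exp (l + l)                  ≤⟨ exp-mono-≤ (begin
      l + l                        ≡⟨ trans (distribʳ l 1# 1#) (cong₂ _+_ (*-identityˡ l) (*-identityˡ l)) ⟨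
      (1# + 1#) * l                ≤⟨ *-monoˡ-≤ (log-fromℕ-nonNeg 1≤k) 2≤qβ ⟩
      fromℕ q * β * l              ≡⟨ solve 3 (λ a b c → a :* b :* c := b :* (a :* c)) refl (fromℕ q) β l ⟩
      β * (fromℕ q * l)            ≡⟨ cong (β *_) (log-fromℕ-^ q 1≤k) ⟨
      β * log (fromℕ (k ℕ.^ q))    ≤⟨ *-monoʳ-≤ 0≤β (log-mono-≤ (fromℕ-pos (ℕ.m^n>0 k q)) (fromℕ-mono-≤ k^q≤y)) ⟩
      β * log (fromℕ y)            ∎) ⟩
    fromℕ y ^ β                  ∎
    where
    l = log (fromℕ k)

  root-bound : ∀ {X k Q} → 1 ℕ.≤ X → 1 ℕ.≤ k → 0# < fromℕ Q → X ℕ.≤ k ℕ.^ Q →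
    fromℕ X ^ (fromℕ Q ⁻¹) ≤ fromℕ k
  root-bound {X} {k} {Q} 1≤X 1≤k 0<Q X≤k^Q = begin
    exp (fromℕ Q ⁻¹ * log (fromℕ X))               ≤⟨ exp-mono-≤ (*-monoʳ-≤ (proj₁ (⁻¹-pos 0<Q))
                                                        (log-mono-≤ (fromℕ-pos 1≤X) (fromℕ-mono-≤ X≤k^Q))) ⟩
    exp (fromℕ Q ⁻¹ * log (fromℕ (k ℕ.^ Q)))       ≡⟨ cong (λ l → exp (fromℕ Q ⁻¹ * l)) (log-fromℕ-^ Q 1≤k) ⟩
    exp (fromℕ Q ⁻¹ * (fromℕ Q * log (fromℕ k)))   ≡⟨ cong exp (trans (*-comm _ _) (trans (cong (_* fromℕ Q ⁻¹) (*-comm _ _))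
                                                        (x*y*y⁻¹ _ (>⇒≢0 0<Q)))) ⟩
    exp (log (fromℕ k))                            ≡⟨ exp-log (fromℕ-pos 1≤k) ⟩
    fromℕ k                                        ∎

  subPolynomial-< : ∀ {f α} → SubPolynomial f → 0# < α → ∃[ b ] ∀ {x} → b ≤ x → f x < x ^ α
  subPolynomial-< {f} {α} sub 0<α = let b , small = proj₂ (proj₂ sub α 0<α) 1# 0<1 in b , λ {x} b≤x →
    subst₂ _<_ (undo x) (*-identityˡ _)
      (*-monoˡ-< (^-pos x α) (≤-<-trans (x≤x⊔y (x ^ (- α) * f x) (- (x ^ (- α) * f x))) (small x b≤x)))
    where
    undo : ∀ x → x ^ (- α) * f x * x ^ α ≡ f x
    undo x = trans (solve 3 (λ a b c → a :* b :* c := c :* a :* b) refl (x ^ (- α)) (f x) (x ^ α))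
      (trans (cong (_* f x) (trans (cong (λ z → x ^ α * exp z) (sym (-‿distribˡ-* α (log x)))) (exp-inverse (α * log x))))
        (*-identityˡ (f x)))

  -- INDEX forces k bits of memory, whereas a sub-polynomial space bound is eventually below (n M) ^
  -- (1 / Q), which is at most k.
  gapPeriodic⇒¬tractable : ∀ {h β} → 𝒢 h → 0# < β → GapPeriodic h β → ¬ Tractable 1 h
  gapPeriodic⇒¬tractable {h} {β} h∈𝒢 0<β gaps tractable
    -- The constant accuracy `ε` is admissible for the constant function `ε ⁻¹`. The bound `q₀`
    -- provides qβ ≥ 2 for q = `suc q₀`, a nonzero exponent.
    with tractable (λ _ → ε ⁻¹) (const-subPolynomial id (⁻¹-pos 0<ε)) (λ _ _ → ε)
           (λ _ _ _ _ → ⁻¹-pos 0<ε , ≤-reflexive (1/x⁻¹≡x 0<ε))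
       | archimedean em ((1# + 1#) / β)
  ... | h* , sub , algorithm , spec | q₀ , 2/β≤q₀
    with subPolynomial-< {α = fromℕ (6 ℕ.+ 2 ℕ.* suc q₀) ⁻¹} sub (⁻¹-pos (fromℕ-pos {6 ℕ.+ 2 ℕ.* suc q₀} (s≤s z≤n)))
       | archimedean em (r * fromℕ 15 / ε)
  ... | B , h*< | K₁ , r*15/ε≤K₁ with archimedean em B
  -- A period of this size has an integer root k of at least 2 + K₁ + K₂: `K₁` makes εk absorb the
  -- factor 15 r, and `K₂` carries n M past `B`.
  ... | K₂ , B≤K₂ with gaps ((2 ℕ.+ K₁ ℕ.+ K₂) ℕ.^ suc q₀)
  ... | x , y , K^q≤y , x<y , 0<hx , _ , period , gap with floor-root (suc q₀) y
  ... | k , k^q≤y , y<[1+k]^q = <⇒≱ (begin-strict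
      fromℕ k                                    ≤⟨ fromℕ-mono-≤ k≤space ⟩
      fromℕ (Algorithm.space (algorithm n m M))  ≤⟨ proj₁ (spec n m M 1≤n 1≤M) ⟩
      h* (fromℕ (n ℕ.* M))                       <⟨ h*< (≤-trans B≤K₂ (fromℕ-mono-≤ K₂≤nM)) ⟩
      fromℕ (n ℕ.* M) ^ (fromℕ Q ⁻¹)             ≤⟨ root-bound {k = k} {Q} (ℕ.*-mono-≤ 1≤n 1≤M) 1≤k
                                                     (fromℕ-pos {Q} (s≤s z≤n)) (nM≤k^ {q = q} 2≤k x<y y<[1+k]^q) ⟩
      fromℕ k                                    ∎) ≤-refl
    where
    q = suc q₀
    Q = 6 ℕ.+ 2 ℕ.* q
    n = 3 ℕ.* (5 ℕ.* k)
    m = n ℕ.+ 1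
    M = x ℕ.+ y
    K≤k : 2 ℕ.+ K₁ ℕ.+ K₂ ℕ.≤ k
    K≤k = ℕ.≮⇒≥ λ k<K → ℕ.<⇒≱ y<[1+k]^q (ℕ.≤-trans (ℕ.^-monoˡ-≤ q k<K) K^q≤y)
    2≤k : 2 ℕ.≤ k
    2≤k = ℕ.≤-trans (ℕ.m≤m+n 2 (K₁ ℕ.+ K₂)) K≤k
    1≤k : 1 ℕ.≤ k
    1≤k = ℕ.≤-trans (s≤s z≤n) 2≤k
    k≤n : k ℕ.≤ n
    k≤n = ℕ.≤-trans (ℕ.m≤n*m k 5) (ℕ.m≤n*m (5 ℕ.* k) 3)
    1≤n : 1 ℕ.≤ n
    1≤n = ℕ.≤-trans 1≤k k≤n
    1≤M : 1 ℕ.≤ M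
    1≤M = ℕ.≤-trans (ℕ.≤-<-trans z≤n x<y) (ℕ.m≤n+m y x)
    K₁≤k : K₁ ℕ.≤ k
    K₁≤k = ℕ.≤-trans (ℕ.≤-trans (ℕ.m≤n+m K₁ 2) (ℕ.m≤m+n _ K₂)) K≤k
    K₂≤nM : K₂ ℕ.≤ n ℕ.* M
    K₂≤nM = ℕ.≤-trans (ℕ.≤-trans (ℕ.m≤n+m K₂ _) K≤k)
      (subst (ℕ._≤ n ℕ.* M) (ℕ.*-identityʳ k) (ℕ.*-mono-≤ k≤n 1≤M))
    h≥0 : ∀ z → 0# ≤ h z
    h≥0 zero    = ≤-reflexive (sym (proj₁ h∈𝒢))
    h≥0 (suc z) = proj₁ (proj₂ (proj₂ h∈𝒢) (suc z) (s≤s z≤n))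
    2≤qβ : 1# + 1# ≤ fromℕ q * β
    2≤qβ = subst (_≤ fromℕ q * β) (x*y⁻¹*y _ (>⇒≢0 0<β))
      (*-monoˡ-≤ (proj₁ 0<β) (≤-trans 2/β≤q₀ (fromℕ-mono-≤ (ℕ.n≤1+n q₀))))
    r*15≤εk : r * fromℕ 15 ≤ ε * fromℕ k
    r*15≤εk = begin
      r * fromℕ 15              ≡⟨ x*y⁻¹*y _ (>⇒≢0 0<ε) ⟨
      r * fromℕ 15 / ε * ε      ≤⟨ *-monoˡ-≤ (proj₁ 0<ε) (≤-trans r*15/ε≤K₁ (fromℕ-mono-≤ K₁≤k)) ⟩
      fromℕ k * ε               ≡⟨ *-comm _ ε ⟩
      ε * fromℕ k               ∎
    small : r * (fromℕ n * h y) ≤ ε * h x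
    small = begin
      r * (fromℕ n * h y)                    ≡⟨ cong (λ z → r * (z * h y)) (trans (cong fromℕ (15k k)) (fromℕ-* 15 k)) ⟩
      r * (fromℕ 15 * fromℕ k * h y)         ≡⟨ trans (cong (r *_) (*-assoc _ _ _)) (sym (*-assoc r _ _)) ⟩
      r * fromℕ 15 * (fromℕ k * h y)         ≤⟨ *-monoˡ-≤ (*-nonNeg (fromℕ-nonNeg k) (h≥0 y)) r*15≤εk ⟩
      ε * fromℕ k * (fromℕ k * h y)          ≡⟨ solve 3 (λ e k h → e :* k :* (k :* h) := e :* (h :* (k :* k))) refl ε (fromℕ k) (h y) ⟩
      ε * (h y * (fromℕ k * fromℕ k))        ≤⟨ *-monoʳ-≤ (proj₁ 0<ε) (*-monoʳ-≤ (h≥0 y) (k²≤y^β {q = q} 1≤k (proj₁ 0<β) k^q≤y 2≤qβ)) ⟩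
      ε * (h y * fromℕ y ^ β)                ≤⟨ *-monoʳ-≤ (proj₁ 0<ε) period ⟩
      ε * h x                                ∎
      where
      15k : ∀ k → 3 ℕ.* (5 ℕ.* k) ≡ 15 ℕ.* k
      15k = solve-∀
    k≤space : k ℕ.≤ Algorithm.space (algorithm n m M)
    k≤space = let guess , separates = threshold (proj₁ h∈𝒢) h≥0 n 0<hx small gap in
      space-lower-bound k (algorithm n m M) h ε x y guess separates
        (λ A b → proj₂ (spec n m M 1≤n 1≤M) _
          (subst (λ l → 𝒟 n l M (embed (indexStream x y A b))) (length-indexStream x y A b)
            (embed-𝒟 (indexStream x y A b) (indexStream-bounded x y A b))))

theorem64 : ExcludedMiddle 0ℓ → (R : Reals) →
    let open Reals R
        open Streaming R in
    (g : ℕ → ℝ) → 𝒢 g → NearlyPeriodic 𝕊 g →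
    (δ : ℝ) → 0# < δ →
    ∃[ h ] 𝒢 h × Normal 𝕊 h × ¬ Tractable 1 h × (∃[ θ ] (Θ[ g , h ]≡ θ) × θ ≤ δ)
theorem64 em R g g∈𝒢 ((α , 0<α , periodic) , _) δ 0<δ
  -- Three halvings give u = δ / 8, so that r = exp (4u) = exp (δ / 2) and r² = exp δ.
  with RealProperties.half R 0<δ
... | δ/2 , 0<δ/2 , refl with RealProperties.half R 0<δ/2
... | δ/4 , 0<δ/4 , refl with RealProperties.half R 0<δ/4 | RealProperties.half R 0<α
... | u , 0<u , refl | β , 0<β , β+β≡α =
  perturbed , perturbed∈𝒢 g∈𝒢 , gapPeriodic⇒normal 0<β gaps ,
  gapPeriodic⇒¬tractable (perturbed∈𝒢 g∈𝒢) 0<β gaps ,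
  perturbed-Θ g∈𝒢 (proj₁ 0<δ) (trans (sym (exp-+ _ _)) (cong exp (cong₂ _+_ (+-assoc (u + u) u u) (+-assoc (u + u) u u))))
  where
  open Reals R
  open RealProperties R
  open Accuracy R 0<u
  open Perturbation em R r 1≤r g α
  open Gaps R r
  open Normality R r 1<r
  open Intractability em R 0<u
  gaps : GapPeriodic perturbed β
  gaps = perturbed-gapPeriodic g∈𝒢 periodic 0<β β+β≡α
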